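{- Let $n\ge1$ and $P=\Phi^+(A_n)=\{(i,j)\colon1\le i,j\le n,\ i+j\ge n+1\}$. For $1\le i\le n$ let $\overline{R}_i\coloneqq\sum_{j'\ge n+1-i}T^-_{(i,j')}+\sum_{i'\ge i}T^-_{(i',n+1-i)}$ (sums over elements of $P$). Then \[\tfrac12\big(\overline{R}_1-\overline{R}_2+\overline{R}_3-\cdots+(-1)^{n-1}\overline{R}_n\big)\equiv^q\begin{cases}0&\text{if $n$ is even},\\ \frac{1}{q+1}&\text{if $n$ is odd}.\end{cases}\]
   Context: $P$ is ordered by $(i,j)\le(i',j')$ iff $i\le i'$ and $j\le j'$. $\mathcal{J}(P)$ is the set of order ideals. For $p\in P$, $I\in\mathcal{J}(P)$: $T_p^+(I)=1$ if $p$ is minimal in $P\setminus I$, else $0$; $T_p^-(I)=1$ if $p$ is maximal in $I$, else $0$; $T_p^q=T_p^+-qT_p^-$ with $q$ an indeterminate. For $f,g\colon\mathcal{J}(P)\to\mathbb{R}(q)$, $f\equiv^q g$ means $f-g=\sum_{p\in P}c_p(q)T_p^q$ for some $c_p(q)\in\mathbb{R}(q)$; an element of $\mathbb{R}(q)$ denotes a constant function. -}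

module Defs where

open import Algebra.Bundles using (CommutativeRing)
import Algebra.Properties.Ring as RingProperties
import Algebra.Properties.Semiring.Exp as SemiringExp
import Algebra.Properties.Semiring.Sum as SemiringSum
import Algebra.Solver.Ring.NaturalCoefficients.Default as NatSolver
open import Data.Bool.Base using (Bool; T; if_then_else_)
open import Data.Bool.Properties using (T?)
open import Data.Fin.Base as Fin using (Fin; toℕ)
import Data.Fin.Properties as Finₚ
open import Data.List.Base using (List; []; _∷_; map)
open import Data.Nat.Base as ℕ using (ℕ; zero; suc)
import Data.Nat.Properties as ℕₚ
open import Data.Product.Base using (∃-syntax; Σ-syntax; _×_; _,_)
import Data.Rational as Rat
open import Data.Rational using (ℚ; 0ℚ; 1ℚ; ½; ∣_∣)
import Data.Rational.Properties as ℚₚ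
import Data.Rational.Solver as ℚ-Solver
open import Level using (0ℓ; _⊔_) renaming (suc to lsuc)
import Relation.Binary.Reasoning.Setoid as SetoidReasoning
open import Relation.Binary.Definitions using (DecidableEquality)
import Relation.Binary.Definitions as Binary
open import Relation.Binary.PropositionalEquality as ≡ using (_≡_)
open import Relation.Binary.Structures using (IsEquivalence)
open import Relation.Nullary using (¬_; Dec; yes; no; does; contradiction; contradiction-irr)
open import Relation.Nullary.Decidable using (¬?; _×-dec_; _→-dec_; map′)
open import Relation.Unary using (Pred; Decidable)

private
  module Rational where
    open ≡ using (refl; sym; trans; cong; cong₂; subst; subst₂)
    open Rat using (_+_; _*_; _-_; -_; _<_; _≤_)
    open ℚ-Solver.+-*-Solver using (solve; _:=_; _:+_; _:*_; _:-_; :-_)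
    open ℚₚ.≤-Reasoning

    *-pos : ∀ {p r} → 0ℚ < p → 0ℚ < r → 0ℚ < p * r
    *-pos {p} {r} 0<p 0<r =
      subst (_< p * r) (ℚₚ.*-zeroʳ p) (ℚₚ.*-monoʳ-<-pos p ⦃ Rat.positive 0<p ⦄ 0<r)

    halve : ∀ ε → 0ℚ < ε → ∃[ δ ] 0ℚ < δ × δ + δ ≡ ε
    halve ε 0<ε = ε * ½ , *-pos 0<ε (ℚₚ.positive⁻¹ ½) ,
      trans (sym (ℚₚ.*-distribˡ-+ ε ½ ½)) (ℚₚ.*-identityʳ ε)

    divide : ∀ ε K → 0ℚ < ε → 0ℚ < K → ∃[ δ ] 0ℚ < δ × K * δ ≡ ε
    divide ε K 0<ε 0<K = 1/K * ε , *-pos (ℚₚ.positive⁻¹ 1/K ⦃ ℚₚ.1/pos⇒pos K ⦃ K⁺ ⦄ ⦄) 0<ε ,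
      trans (sym (ℚₚ.*-assoc K 1/K ε))
        (trans (cong (_* ε) (ℚₚ.*-inverseʳ K ⦃ K≢0 ⦄)) (ℚₚ.*-identityˡ ε))
      where
      K⁺ = Rat.positive 0<K
      K≢0 = ℚₚ.pos⇒nonZero K ⦃ K⁺ ⦄
      1/K = Rat.1/_ K ⦃ K≢0 ⦄

    ∣p-p∣≡0 : ∀ p → ∣ p - p ∣ ≡ 0ℚ
    ∣p-p∣≡0 p = cong ∣_∣ (ℚₚ.+-inverseʳ p)

    ∣p-q∣≡∣q-p∣ : ∀ p q → ∣ p - q ∣ ≡ ∣ q - p ∣
    ∣p-q∣≡∣q-p∣ p q = trans (sym (ℚₚ.∣-p∣≡∣p∣ (p - q))) (cong ∣_∣ (eq p q))
      where
      eq : ∀ p q → - (p - q) ≡ q - p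
      eq = solve 2 (λ p q → (:- (p :- q)) := q :- p) refl

    p-0≡p : ∀ p → p - 0ℚ ≡ p
    p-0≡p = ℚₚ.+-identityʳ

    ∣p∣≤∣p-q∣+∣q∣ : ∀ p q → ∣ p ∣ ≤ ∣ p - q ∣ + ∣ q ∣
    ∣p∣≤∣p-q∣+∣q∣ p q =
      subst (λ t → ∣ t ∣ ≤ ∣ p - q ∣ + ∣ q ∣) (eq p q) (ℚₚ.∣p+q∣≤∣p∣+∣q∣ (p - q) q)
      where
      eq : ∀ p q → (p - q) + q ≡ p
      eq = solve 2 (λ p q → (p :- q) :+ q := p) refl

    triangle : ∀ p q r → ∣ p - r ∣ ≤ ∣ p - q ∣ + ∣ q - r ∣
    triangle p q r =
      subst (λ t → ∣ t ∣ ≤ ∣ p - q ∣ + ∣ q - r ∣) (eq p q r) (ℚₚ.∣p+q∣≤∣p∣+∣q∣ (p - q) (q - r))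
      where
      eq : ∀ p q r → (p - q) + (q - r) ≡ p - r
      eq = solve 3 (λ p q r → (p :- q) :+ (q :- r) := p :- r) refl

    +-close : ∀ {δ ε} a a′ b b′ → ∣ a - a′ ∣ < δ → ∣ b - b′ ∣ < δ → δ + δ ≡ ε →
              ∣ (a + b) - (a′ + b′) ∣ < ε
    +-close {δ} {ε} a a′ b b′ p q δ+δ≡ε = begin-strict
      ∣ (a + b) - (a′ + b′) ∣  ≡⟨ cong ∣_∣ (eq a a′ b b′) ⟩
      ∣ (a - a′) + (b - b′) ∣  ≤⟨ ℚₚ.∣p+q∣≤∣p∣+∣q∣ (a - a′) (b - b′) ⟩
      ∣ a - a′ ∣ + ∣ b - b′ ∣  <⟨ ℚₚ.+-mono-< p q ⟩
      δ + δ                    ≡⟨ δ+δ≡ε ⟩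
      ε                        ∎
      where
      eq : ∀ a a′ b b′ → (a + b) - (a′ + b′) ≡ (a - a′) + (b - b′)
      eq = solve 4 (λ a a′ b b′ → (a :+ b) :- (a′ :+ b′) := (a :- a′) :+ (b :- b′)) refl

    -‿close : ∀ {ε} a a′ → ∣ a - a′ ∣ < ε → ∣ - a - - a′ ∣ < ε
    -‿close {ε} a a′ p = subst (_< ε) (trans (∣p-q∣≡∣q-p∣ a a′) (cong ∣_∣ (eq a a′))) p
      where
      eq : ∀ a a′ → a′ - a ≡ - a - - a′
      eq = solve 2 (λ a a′ → a′ :- a := (:- a) :- (:- a′)) refl

    *-mono-<-abs : ∀ {K δ} a b → 0ℚ < K → ∣ a ∣ ≤ K → ∣ b ∣ < δ → ∣ a * b ∣ < K * δ
    *-mono-<-abs {K} {δ} a b 0<K p q = begin-strict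
      ∣ a * b ∣      ≡⟨ ℚₚ.∣p*q∣≡∣p∣*∣q∣ a b ⟩
      ∣ a ∣ * ∣ b ∣  ≤⟨ ℚₚ.*-monoʳ-≤-nonNeg ∣ b ∣ ⦃ Rat.nonNegative (ℚₚ.0≤∣p∣ b) ⦄ p ⟩
      K * ∣ b ∣      <⟨ ℚₚ.*-monoʳ-<-pos K ⦃ Rat.positive 0<K ⦄ q ⟩
      K * δ          ∎

    *-close : ∀ {K L δ η θ ε} a a′ b b′ → 0ℚ < K → 0ℚ < L → ∣ a ∣ ≤ K → ∣ b′ ∣ ≤ L →
              ∣ a - a′ ∣ < δ → ∣ b - b′ ∣ < η → L * δ ≡ θ → K * η ≡ θ → θ + θ ≡ ε →
              ∣ a * b - a′ * b′ ∣ < ε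
    *-close {K} {L} {δ} {η} {θ} {ε} a a′ b b′ 0<K 0<L ka lb p q Lδ Kη θθ = begin-strict
      ∣ a * b - a′ * b′ ∣                    ≡⟨ cong ∣_∣ (eq a a′ b b′) ⟩
      ∣ a * (b - b′) + b′ * (a - a′) ∣       ≤⟨ ℚₚ.∣p+q∣≤∣p∣+∣q∣ (a * (b - b′)) (b′ * (a - a′)) ⟩
      ∣ a * (b - b′) ∣ + ∣ b′ * (a - a′) ∣   <⟨ ℚₚ.+-mono-< (*-mono-<-abs a (b - b′) 0<K ka q)
                                                           (*-mono-<-abs b′ (a - a′) 0<L lb p) ⟩
      K * η + L * δ                          ≡⟨ cong₂ _+_ Kη Lδ ⟩
      θ + θ                                  ≡⟨ θθ ⟩
      ε                                      ∎
      where
      eq : ∀ a a′ b b′ → a * b - a′ * b′ ≡ a * (b - b′) + b′ * (a - a′)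
      eq = solve 4 (λ a a′ b b′ → a :* b :- a′ :* b′ := a :* (b :- b′) :+ b′ :* (a :- a′)) refl

-- The real numbers: Cauchy sequences of rationals, modulo null sequences.

record ℝ : Set where
  constructor mkℝ
  field
    seq    : ℕ → ℚ
    cauchy : ∀ ε → 0ℚ Rat.< ε → ∃[ N ] ∀ m n → N ℕ.≤ m → N ℕ.≤ n →
             ∣ seq m Rat.- seq n ∣ Rat.< ε

infix 4 _≈ᴿ_
record _≈ᴿ_ (x y : ℝ) : Set where
  constructor mk≈ᴿ
  field
    close : ∀ ε → 0ℚ Rat.< ε → ∃[ N ] ∀ n → N ℕ.≤ n →
            ∣ ℝ.seq x n Rat.- ℝ.seq y n ∣ Rat.< ε

module RealField where
  open Rational
  open ≡ using (refl; sym; trans; cong; cong₂; subst; subst₂)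
  open ℝ
  open _≈ᴿ_
  open Rat using (_+_; _*_; _-_; -_; _<_; _≤_)
  open ℚₚ.≤-Reasoning

  private
    eventually-bounded : ∀ x → ∃[ K ] 0ℚ < K × (∃[ N ] ∀ n → N ℕ.≤ n → ∣ seq x n ∣ ≤ K)
    eventually-bounded x with cauchy x 1ℚ (ℚₚ.positive⁻¹ 1ℚ)
    ... | N , bound = 1ℚ + ∣ seq x N ∣ ,
          ℚₚ.<-≤-trans (ℚₚ.positive⁻¹ 1ℚ)
            (subst (_≤ 1ℚ + ∣ seq x N ∣) (ℚₚ.+-identityʳ 1ℚ) (ℚₚ.+-monoʳ-≤ 1ℚ (ℚₚ.0≤∣p∣ (seq x N)))) ,
          N , λ n N≤n → ℚₚ.≤-trans (∣p∣≤∣p-q∣+∣q∣ (seq x n) (seq x N))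
            (ℚₚ.+-monoˡ-≤ ∣ seq x N ∣ (ℚₚ.<⇒≤ (bound n N N≤n ℕₚ.≤-refl)))

    ⊔-l : ∀ {k} m n → m ℕ.⊔ n ℕ.≤ k → m ℕ.≤ k
    ⊔-l = ℕₚ.m⊔n≤o⇒m≤o

    ⊔-r : ∀ {k} m n → m ℕ.⊔ n ℕ.≤ k → n ℕ.≤ k
    ⊔-r = ℕₚ.m⊔n≤o⇒n≤o

  private
    Cauchy : (ℕ → ℚ) → Set
    Cauchy s = ∀ ε → 0ℚ < ε → ∃[ N ] ∀ m n → N ℕ.≤ m → N ℕ.≤ n → ∣ s m - s n ∣ < ε

    abstract
      const-cauchy : ∀ p → Cauchy (λ _ → p)
      const-cauchy p ε 0<ε = 0 , λ _ _ _ _ → subst (_< ε) (sym (∣p-p∣≡0 p)) 0<ε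

      +-cauchy : ∀ x y → Cauchy (λ n → seq x n + seq y n)
      +-cauchy x y ε 0<ε =
        let δ , 0<δ , δ+δ≡ε = halve ε 0<ε
            M , p = cauchy x δ 0<δ
            N , q = cauchy y δ 0<δ
        in M ℕ.⊔ N , λ m n b c → +-close (seq x m) (seq x n) (seq y m) (seq y n)
             (p m n (⊔-l M N b) (⊔-l M N c)) (q m n (⊔-r M N b) (⊔-r M N c)) δ+δ≡ε

      neg-cauchy : ∀ x → Cauchy (λ n → - seq x n)
      neg-cauchy x ε 0<ε =
        let N , p = cauchy x ε 0<ε
        in N , λ m n b c → -‿close (seq x m) (seq x n) (p m n b c)

      *-cauchy : ∀ x y → Cauchy (λ n → seq x n * seq y n)
      *-cauchy x y ε 0<ε =
        let K , 0<K , A , k = eventually-bounded x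
            L , 0<L , B , l = eventually-bounded y
            θ , 0<θ , θθ = halve ε 0<ε
            δ , 0<δ , Lδ = divide θ L 0<θ 0<L
            η , 0<η , Kη = divide θ K 0<θ 0<K
            M , p = cauchy x δ 0<δ
            N , q = cauchy y η 0<η
        in (A ℕ.⊔ B) ℕ.⊔ (M ℕ.⊔ N) , λ m n b c →
             *-close (seq x m) (seq x n) (seq y m) (seq y n) 0<K 0<L
               (k m (⊔-l A B (⊔-l (A ℕ.⊔ B) (M ℕ.⊔ N) b)))
               (l n (⊔-r A B (⊔-l (A ℕ.⊔ B) (M ℕ.⊔ N) c)))
               (p m n (⊔-l M N (⊔-r (A ℕ.⊔ B) (M ℕ.⊔ N) b)) (⊔-l M N (⊔-r (A ℕ.⊔ B) (M ℕ.⊔ N) c)))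
               (q m n (⊔-r M N (⊔-r (A ℕ.⊔ B) (M ℕ.⊔ N) b)) (⊔-r M N (⊔-r (A ℕ.⊔ B) (M ℕ.⊔ N) c)))
               Lδ Kη θθ

  fromℚ : ℚ → ℝ
  fromℚ p = mkℝ (λ _ → p) (const-cauchy p)

  infixl 6 _+ᴿ_
  infixl 7 _*ᴿ_
  infix  8 -ᴿ_

  _+ᴿ_ _*ᴿ_ : ℝ → ℝ → ℝ
  x +ᴿ y = mkℝ (λ n → seq x n + seq y n) (+-cauchy x y)
  x *ᴿ y = mkℝ (λ n → seq x n * seq y n) (*-cauchy x y)

  -ᴿ_ : ℝ → ℝ
  -ᴿ x = mkℝ (λ n → - seq x n) (neg-cauchy x)

  private
    pointwise : ∀ x y → (∀ n → seq x n ≡ seq y n) → x ≈ᴿ y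
    pointwise x y eq .close ε 0<ε = 0 , λ n _ →
      subst (_< ε) (sym (trans (cong (λ t → ∣ t - seq y n ∣) (eq n)) (∣p-p∣≡0 (seq y n)))) 0<ε

    ≈ᴿ-sym : ∀ {x y} → x ≈ᴿ y → y ≈ᴿ x
    ≈ᴿ-sym {x} {y} x≈y .close ε 0<ε =
      let N , p = x≈y .close ε 0<ε
      in N , λ n b → subst (_< ε) (∣p-q∣≡∣q-p∣ (seq x n) (seq y n)) (p n b)

    ≈ᴿ-trans : ∀ {x y z} → x ≈ᴿ y → y ≈ᴿ z → x ≈ᴿ z
    ≈ᴿ-trans {x} {y} {z} x≈y y≈z .close ε 0<ε =
      let δ , 0<δ , δ+δ≡ε = halve ε 0<ε
          M , p = x≈y .close δ 0<δ
          N , q = y≈z .close δ 0<δ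
      in M ℕ.⊔ N , λ n b → ℚₚ.≤-<-trans (triangle (seq x n) (seq y n) (seq z n))
           (subst (∣ seq x n - seq y n ∣ + ∣ seq y n - seq z n ∣ <_) δ+δ≡ε
             (ℚₚ.+-mono-< (p n (⊔-l M N b)) (q n (⊔-r M N b))))

    +ᴿ-cong : ∀ {x x′ y y′} → x ≈ᴿ x′ → y ≈ᴿ y′ → x +ᴿ y ≈ᴿ x′ +ᴿ y′
    +ᴿ-cong {x} {x′} {y} {y′} x≈ y≈ .close ε 0<ε =
      let δ , 0<δ , δ+δ≡ε = halve ε 0<ε
          M , p = x≈ .close δ 0<δ
          N , q = y≈ .close δ 0<δ
      in M ℕ.⊔ N , λ n b → +-close (seq x n) (seq x′ n) (seq y n) (seq y′ n)
           (p n (⊔-l M N b)) (q n (⊔-r M N b)) δ+δ≡ε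

    -ᴿ-cong : ∀ {x x′} → x ≈ᴿ x′ → -ᴿ x ≈ᴿ -ᴿ x′
    -ᴿ-cong {x} {x′} x≈ .close ε 0<ε =
      let N , p = x≈ .close ε 0<ε
      in N , λ n b → -‿close (seq x n) (seq x′ n) (p n b)

    *ᴿ-cong : ∀ {x x′ y y′} → x ≈ᴿ x′ → y ≈ᴿ y′ → x *ᴿ y ≈ᴿ x′ *ᴿ y′
    *ᴿ-cong {x} {x′} {y} {y′} x≈ y≈ .close ε 0<ε =
      let K , 0<K , A , k = eventually-bounded x
          L , 0<L , B , l = eventually-bounded y′
          θ , 0<θ , θθ = halve ε 0<ε
          δ , 0<δ , Lδ = divide θ L 0<θ 0<L
          η , 0<η , Kη = divide θ K 0<θ 0<K
          M , p = x≈ .close δ 0<δ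
          N , q = y≈ .close η 0<η
      in (A ℕ.⊔ B) ℕ.⊔ (M ℕ.⊔ N) , λ n b →
           *-close (seq x n) (seq x′ n) (seq y n) (seq y′ n) 0<K 0<L
             (k n (⊔-l A B (⊔-l (A ℕ.⊔ B) (M ℕ.⊔ N) b)))
             (l n (⊔-r A B (⊔-l (A ℕ.⊔ B) (M ℕ.⊔ N) b)))
             (p n (⊔-l M N (⊔-r (A ℕ.⊔ B) (M ℕ.⊔ N) b)))
             (q n (⊔-r M N (⊔-r (A ℕ.⊔ B) (M ℕ.⊔ N) b)))
             Lδ Kη θθ

    ≈ᴿ-isEquivalence : IsEquivalence _≈ᴿ_
    ≈ᴿ-isEquivalence = record
      { refl  = λ {x} → pointwise x x λ _ → refl
      ; sym   = ≈ᴿ-sym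
      ; trans = ≈ᴿ-trans
      }

  0ᴿ 1ᴿ : ℝ
  0ᴿ = fromℚ 0ℚ
  1ᴿ = fromℚ 1ℚ

  ℝ-commutativeRing : CommutativeRing 0ℓ 0ℓ
  ℝ-commutativeRing = record
    { Carrier = ℝ ; _≈_ = _≈ᴿ_ ; _+_ = _+ᴿ_ ; _*_ = _*ᴿ_ ; -_ = -ᴿ_ ; 0# = 0ᴿ ; 1# = 1ᴿ
    ; isCommutativeRing = record
      { isRing = record
        { +-isAbelianGroup = record
          { isGroup = record
            { isMonoid = record
              { isSemigroup = record
                { isMagma = record
                  { isEquivalence = ≈ᴿ-isEquivalence
                  ; ∙-cong = λ {x} {x′} {y} {y′} → +ᴿ-cong {x} {x′} {y} {y′} }
                ; assoc = λ x y z → pointwise (x +ᴿ y +ᴿ z) (x +ᴿ (y +ᴿ z)) λ n → ℚₚ.+-assoc (seq x n) (seq y n) (seq z n) }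
              ; identity = (λ x → pointwise (0ᴿ +ᴿ x) x λ n → ℚₚ.+-identityˡ (seq x n))
                         , (λ x → pointwise (x +ᴿ 0ᴿ) x λ n → ℚₚ.+-identityʳ (seq x n)) }
            ; inverse = (λ x → pointwise (-ᴿ x +ᴿ x) 0ᴿ λ n → ℚₚ.+-inverseˡ (seq x n))
                      , (λ x → pointwise (x +ᴿ -ᴿ x) 0ᴿ λ n → ℚₚ.+-inverseʳ (seq x n))
            ; ⁻¹-cong = λ {x} {x′} → -ᴿ-cong {x} {x′} }
          ; comm = λ x y → pointwise (x +ᴿ y) (y +ᴿ x) λ n → ℚₚ.+-comm (seq x n) (seq y n) }
        ; *-cong = λ {x} {x′} {y} {y′} → *ᴿ-cong {x} {x′} {y} {y′}
        ; *-assoc = λ x y z → pointwise (x *ᴿ y *ᴿ z) (x *ᴿ (y *ᴿ z)) λ n → ℚₚ.*-assoc (seq x n) (seq y n) (seq z n)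
        ; *-identity = (λ x → pointwise (1ᴿ *ᴿ x) x λ n → ℚₚ.*-identityˡ (seq x n))
                     , (λ x → pointwise (x *ᴿ 1ᴿ) x λ n → ℚₚ.*-identityʳ (seq x n))
        ; distrib = (λ x y z → pointwise (x *ᴿ (y +ᴿ z)) (x *ᴿ y +ᴿ x *ᴿ z) λ n → ℚₚ.*-distribˡ-+ (seq x n) (seq y n) (seq z n))
                  , (λ x y z → pointwise ((y +ᴿ z) *ᴿ x) (y *ᴿ x +ᴿ z *ᴿ x) λ n → ℚₚ.*-distribʳ-+ (seq x n) (seq y n) (seq z n)) }
      ; *-comm = λ x y → pointwise (x *ᴿ y) (y *ᴿ x) λ n → ℚₚ.*-comm (seq x n) (seq y n) } }

  private
    infix 4 _#_
    _#_ : ℝ → ℝ → Set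
    x # y = ∃[ ε ] 0ℚ < ε × (∃[ N ] ∀ n → N ℕ.≤ n → ε ≤ ∣ seq x n - seq y n ∣)

    #⇒≉ : ∀ x y → x # y → ¬ x ≈ᴿ y
    #⇒≉ x y (ε , 0<ε , M , p) x≈y =
      let N , q = x≈y .close ε 0<ε
          n = M ℕ.⊔ N
      in ℚₚ.<-irrefl refl (ℚₚ.≤-<-trans (p n (ℕₚ.m≤m⊔n M N)) (q n (ℕₚ.m≤n⊔m M N)))

    near : ∀ {δ η ε} r t → ∣ r - t ∣ < η → ∣ t ∣ < δ → η + η ≡ δ → δ + δ ≡ ε → 0ℚ < η → ∣ r ∣ < ε
    near {δ} {η} {ε} r t p q η+η≡δ δ+δ≡ε 0<η = begin-strict
      ∣ r ∣              ≤⟨ ∣p∣≤∣p-q∣+∣q∣ r t ⟩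
      ∣ r - t ∣ + ∣ t ∣  <⟨ ℚₚ.+-mono-< p q ⟩
      η + δ              <⟨ ℚₚ.+-monoˡ-< δ (subst₂ _<_ (ℚₚ.+-identityʳ η) η+η≡δ (ℚₚ.+-monoʳ-< η 0<η)) ⟩
      δ + δ              ≡⟨ δ+δ≡ε ⟩
      ε                  ∎

    far : ∀ {δ η} r t → ∣ t - r ∣ < η → ¬ ∣ t ∣ < δ → η + η ≡ δ → η ≤ ∣ r ∣
    far {δ} {η} r t p t≮δ η+η≡δ = ℚₚ.≮⇒≥ λ r<η → t≮δ (begin-strict
      ∣ t ∣              ≤⟨ ∣p∣≤∣p-q∣+∣q∣ t r ⟩
      ∣ t - r ∣ + ∣ r ∣  <⟨ ℚₚ.+-mono-< p r<η ⟩
      η + η              ≡⟨ η+η≡δ ⟩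
      δ                  ∎)

    ¬#⇒≈ : ∀ x y → ¬ x # y → x ≈ᴿ y
    ¬#⇒≈ x y ¬x#y .close ε 0<ε =
      let δ , 0<δ , δ+δ≡ε = halve ε 0<ε
          η , 0<η , η+η≡δ = halve δ 0<δ
          N , near-N = cauchy (x +ᴿ -ᴿ y) η 0<η
      in case (seq x N - seq y N) N δ η 0<η η+η≡δ δ+δ≡ε (λ n b → near-N n N b ℕₚ.≤-refl) (λ n b → near-N N n ℕₚ.≤-refl b) (∣ seq x N - seq y N ∣ ℚₚ.<? δ)
      where
      case : ∀ t N δ η → 0ℚ < η → η + η ≡ δ → δ + δ ≡ ε →
             (∀ n → N ℕ.≤ n → ∣ (seq x n - seq y n) - t ∣ < η) →
             (∀ n → N ℕ.≤ n → ∣ t - (seq x n - seq y n) ∣ < η) →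
             Dec (∣ t ∣ < δ) → ∃[ M ] ∀ n → M ℕ.≤ n → ∣ seq x n - seq y n ∣ < ε
      case t N δ η 0<η η+η≡δ δ+δ≡ε p _ (yes t<δ) =
        N , λ n b → near (seq x n - seq y n) t (p n b) t<δ η+η≡δ δ+δ≡ε 0<η
      case t N δ η 0<η η+η≡δ _ _ p (no t≮δ) = contradiction
        (η , 0<η , N , λ n b → far (seq x n - seq y n) t (p n b) t≮δ η+η≡δ) ¬x#y

    *-# : ∀ x y → x # 0ᴿ → y # 0ᴿ → (x *ᴿ y) # 0ᴿ
    *-# x y (ε , 0<ε , M , p) (δ , 0<δ , N , q) = ε * δ , *-pos 0<ε 0<δ , M ℕ.⊔ N , λ n b → begin
      ε * δ                              ≤⟨ ℚₚ.*-monoʳ-≤-nonNeg δ ⦃ Rat.nonNegative (ℚₚ.<⇒≤ 0<δ) ⦄ (p n (⊔-l M N b)) ⟩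
      ∣ seq x n - 0ℚ ∣ * δ               ≤⟨ ℚₚ.*-monoˡ-≤-nonNeg ∣ seq x n - 0ℚ ∣ ⦃ Rat.nonNegative (ℚₚ.0≤∣p∣ (seq x n - 0ℚ)) ⦄ (q n (⊔-r M N b)) ⟩
      ∣ seq x n - 0ℚ ∣ * ∣ seq y n - 0ℚ ∣  ≡⟨ ℚₚ.∣p*q∣≡∣p∣*∣q∣ (seq x n - 0ℚ) (seq y n - 0ℚ) ⟨
      ∣ (seq x n - 0ℚ) * (seq y n - 0ℚ) ∣  ≡⟨ cong ∣_∣ (trans (cong₂ _*_ (p-0≡p (seq x n)) (p-0≡p (seq y n))) (sym (p-0≡p (seq x n * seq y n)))) ⟩
      ∣ seq x n * seq y n - 0ℚ ∣         ∎

  ≈ᴿ-stable : ∀ x y → ¬ ¬ x ≈ᴿ y → x ≈ᴿ y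
  ≈ᴿ-stable x y ¬¬x≈y = ¬#⇒≈ x y λ x#y → ¬¬x≈y (#⇒≉ x y x#y)

  *ᴿ-noZeroDivisors : ∀ x y → ¬ x ≈ᴿ 0ᴿ → ¬ y ≈ᴿ 0ᴿ → ¬ (x *ᴿ y) ≈ᴿ 0ᴿ
  *ᴿ-noZeroDivisors x y x≉0 y≉0 xy≈0 =
    x≉0 (¬#⇒≈ x 0ᴿ λ x#0 → y≉0 (¬#⇒≈ y 0ᴿ λ y#0 → #⇒≉ (x *ᴿ y) 0ᴿ (*-# x y x#0 y#0) xy≈0))

  fromℚ-≉0 : ∀ p → 0ℚ < p → ¬ fromℚ p ≈ᴿ 0ᴿ
  fromℚ-≉0 p 0<p = #⇒≉ (fromℚ p) 0ᴿ (p , 0<p , 0 , λ _ _ → ℚₚ.≤-reflexive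
    (sym (trans (cong ∣_∣ (p-0≡p p)) (ℚₚ.0≤p⇒∣p∣≡p (ℚₚ.<⇒≤ 0<p)))))

  fromℚ-+ : ∀ p r → fromℚ (p + r) ≈ᴿ fromℚ p +ᴿ fromℚ r
  fromℚ-+ p r = pointwise (fromℚ (p + r)) (fromℚ p +ᴿ fromℚ r) λ _ → refl

-- Classically every equality is ¬¬-stable.  Constructively this is what makes
-- equality of fractions transitive when nonzero means ¬ x ≈ 0#.

record IntegralDomain c ℓ : Set (lsuc (c ⊔ ℓ)) where
  field
    commutativeRing : CommutativeRing c ℓ
  open CommutativeRing commutativeRing public
  field
    1≉0            : ¬ 1# ≈ 0#
    noZeroDivisors : ∀ x y → ¬ x ≈ 0# → ¬ y ≈ 0# → ¬ x * y ≈ 0#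
    ¬¬-stable      : ∀ x y → ¬ ¬ x ≈ y → x ≈ y

module Polynomials {c ℓ} (D : IntegralDomain c ℓ) where
  open IntegralDomain D hiding (zero)
  open RingProperties ring using (-0#≈0#)
  open SetoidReasoning setoid
  open NatSolver commutativeSemiring using (solve; _:=_; _:+_)

  -- Coefficient lists, constant term first; trailing zeros are irrelevant.

  Poly : Set c
  Poly = List Carrier

  coeff : Poly → ℕ → Carrier
  coeff []      _       = 0#
  coeff (a ∷ p) zero    = a
  coeff (a ∷ p) (suc n) = coeff p n

  infix  4 _≈ₚ_
  infixl 6 _+ₚ_
  infixl 7 _*ₚ_ _∙ₚ_
  infix  8 -ₚ_

  record _≈ₚ_ (p r : Poly) : Set ℓ where
    constructor mk≈ₚ
    field at : ∀ n → coeff p n ≈ coeff r n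
  open _≈ₚ_ public

  0ₚ 1ₚ X : Poly
  0ₚ = []
  1ₚ = 1# ∷ []
  X  = 0# ∷ 1# ∷ []

  _+ₚ_ : Poly → Poly → Poly
  []      +ₚ r       = r
  (a ∷ p) +ₚ []      = a ∷ p
  (a ∷ p) +ₚ (b ∷ r) = a + b ∷ p +ₚ r

  -ₚ_ : Poly → Poly
  -ₚ_ = map (-_)

  _∙ₚ_ : Carrier → Poly → Poly
  a ∙ₚ r = map (a *_) r

  _*ₚ_ : Poly → Poly → Poly
  []      *ₚ r = []
  (a ∷ p) *ₚ r = a ∙ₚ r +ₚ (0# ∷ p *ₚ r)

  private
    coeff-+ : ∀ p r n → coeff (p +ₚ r) n ≈ coeff p n + coeff r n
    coeff-+ []      r       n       = sym (+-identityˡ _)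
    coeff-+ (a ∷ p) []      n       = sym (+-identityʳ _)
    coeff-+ (a ∷ p) (b ∷ r) zero    = refl
    coeff-+ (a ∷ p) (b ∷ r) (suc n) = coeff-+ p r n

    coeff-neg : ∀ p n → coeff (-ₚ p) n ≈ - coeff p n
    coeff-neg []      n       = sym -0#≈0#
    coeff-neg (a ∷ p) zero    = refl
    coeff-neg (a ∷ p) (suc n) = coeff-neg p n

    coeff-∙ : ∀ a r n → coeff (a ∙ₚ r) n ≈ a * coeff r n
    coeff-∙ a []      n       = sym (zeroʳ a)
    coeff-∙ a (b ∷ r) zero    = refl
    coeff-∙ a (b ∷ r) (suc n) = coeff-∙ a r n

    ≈ₚ-refl : ∀ {p} → p ≈ₚ p
    ≈ₚ-refl .at n = refl

    ≈ₚ-sym : ∀ {p r} → p ≈ₚ r → r ≈ₚ p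
    ≈ₚ-sym e .at n = sym (e .at n)

    ≈ₚ-trans : ∀ {p r s} → p ≈ₚ r → r ≈ₚ s → p ≈ₚ s
    ≈ₚ-trans e f .at n = trans (e .at n) (f .at n)

    ∷-cong : ∀ {a b p r} → a ≈ b → p ≈ₚ r → a ∷ p ≈ₚ b ∷ r
    ∷-cong e f .at zero    = e
    ∷-cong e f .at (suc n) = f .at n

    0∷[] : 0# ∷ [] ≈ₚ []
    0∷[] .at zero    = refl
    0∷[] .at (suc n) = refl

    +ₚ-cong : ∀ {p p′ r r′} → p ≈ₚ p′ → r ≈ₚ r′ → p +ₚ r ≈ₚ p′ +ₚ r′
    +ₚ-cong {p} {p′} {r} {r′} e f .at n =
      trans (coeff-+ p r n) (trans (+-cong (e .at n) (f .at n)) (sym (coeff-+ p′ r′ n)))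

    +ₚ-assoc : ∀ p r s → (p +ₚ r) +ₚ s ≈ₚ p +ₚ (r +ₚ s)
    +ₚ-assoc p r s .at n = begin
      coeff ((p +ₚ r) +ₚ s) n               ≈⟨ coeff-+ (p +ₚ r) s n ⟩
      coeff (p +ₚ r) n + coeff s n          ≈⟨ +-congʳ (coeff-+ p r n) ⟩
      (coeff p n + coeff r n) + coeff s n   ≈⟨ +-assoc _ _ _ ⟩
      coeff p n + (coeff r n + coeff s n)   ≈⟨ +-congˡ (coeff-+ r s n) ⟨
      coeff p n + coeff (r +ₚ s) n          ≈⟨ coeff-+ p (r +ₚ s) n ⟨
      coeff (p +ₚ (r +ₚ s)) n               ∎

    +ₚ-comm : ∀ p r → p +ₚ r ≈ₚ r +ₚ p
    +ₚ-comm p r .at n = trans (coeff-+ p r n) (trans (+-comm _ _) (sym (coeff-+ r p n)))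

    +ₚ-identityʳ : ∀ p → p +ₚ [] ≈ₚ p
    +ₚ-identityʳ p = +ₚ-comm p []

    -ₚ-cong : ∀ {p r} → p ≈ₚ r → -ₚ p ≈ₚ -ₚ r
    -ₚ-cong {p} {r} e .at n = trans (coeff-neg p n) (trans (-‿cong (e .at n)) (sym (coeff-neg r n)))

    -ₚ-inverseʳ : ∀ p → p +ₚ -ₚ p ≈ₚ []
    -ₚ-inverseʳ p .at n = trans (coeff-+ p (-ₚ p) n) (trans (+-congˡ (coeff-neg p n)) (-‿inverseʳ _))

    -ₚ-inverseˡ : ∀ p → -ₚ p +ₚ p ≈ₚ []
    -ₚ-inverseˡ p = ≈ₚ-trans (+ₚ-comm (-ₚ p) p) (-ₚ-inverseʳ p)

    ∙-cong : ∀ a {p r} → p ≈ₚ r → a ∙ₚ p ≈ₚ a ∙ₚ r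
    ∙-cong a {p} {r} e .at n = trans (coeff-∙ a p n) (trans (*-congˡ (e .at n)) (sym (coeff-∙ a r n)))

    interchange : ∀ p r s t → (p +ₚ r) +ₚ (s +ₚ t) ≈ₚ (p +ₚ s) +ₚ (r +ₚ t)
    interchange p r s t .at n = begin
      coeff ((p +ₚ r) +ₚ (s +ₚ t)) n                            ≈⟨ expand p r s t ⟩
      (coeff p n + coeff r n) + (coeff s n + coeff t n)
        ≈⟨ solve 4 (λ a b c d → (a :+ b) :+ (c :+ d) := (a :+ c) :+ (b :+ d)) refl _ _ _ _ ⟩
      (coeff p n + coeff s n) + (coeff r n + coeff t n)         ≈⟨ expand p s r t ⟨
      coeff ((p +ₚ s) +ₚ (r +ₚ t)) n                            ∎
      where
      expand : ∀ p r s t → coeff ((p +ₚ r) +ₚ (s +ₚ t)) n ≈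
                           (coeff p n + coeff r n) + (coeff s n + coeff t n)
      expand p r s t = trans (coeff-+ (p +ₚ r) (s +ₚ t) n) (+-cong (coeff-+ p r n) (coeff-+ s t n))

    shift-+ : ∀ p r → 0# ∷ (p +ₚ r) ≈ₚ (0# ∷ p) +ₚ (0# ∷ r)
    shift-+ p r = ∷-cong (sym (+-identityˡ 0#)) ≈ₚ-refl

    ∙-distribˡ : ∀ a p r → a ∙ₚ (p +ₚ r) ≈ₚ a ∙ₚ p +ₚ a ∙ₚ r
    ∙-distribˡ a p r .at n = begin
      coeff (a ∙ₚ (p +ₚ r)) n            ≈⟨ coeff-∙ a (p +ₚ r) n ⟩
      a * coeff (p +ₚ r) n               ≈⟨ *-congˡ (coeff-+ p r n) ⟩
      a * (coeff p n + coeff r n)        ≈⟨ distribˡ _ _ _ ⟩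
      a * coeff p n + a * coeff r n      ≈⟨ +-cong (coeff-∙ a p n) (coeff-∙ a r n) ⟨
      coeff (a ∙ₚ p) n + coeff (a ∙ₚ r) n  ≈⟨ coeff-+ (a ∙ₚ p) (a ∙ₚ r) n ⟨
      coeff (a ∙ₚ p +ₚ a ∙ₚ r) n         ∎

    ∙-assoc : ∀ a b p → (a * b) ∙ₚ p ≈ₚ a ∙ₚ (b ∙ₚ p)
    ∙-assoc a b p .at n = begin
      coeff ((a * b) ∙ₚ p) n   ≈⟨ coeff-∙ (a * b) p n ⟩
      a * b * coeff p n        ≈⟨ *-assoc _ _ _ ⟩
      a * (b * coeff p n)      ≈⟨ *-congˡ (coeff-∙ b p n) ⟨
      a * coeff (b ∙ₚ p) n     ≈⟨ coeff-∙ a (b ∙ₚ p) n ⟨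
      coeff (a ∙ₚ (b ∙ₚ p)) n  ∎

    ∙-shift : ∀ a p → a ∙ₚ (0# ∷ p) ≈ₚ 0# ∷ a ∙ₚ p
    ∙-shift a p = ∷-cong (zeroʳ a) ≈ₚ-refl

    0∙ : ∀ p → 0# ∙ₚ p ≈ₚ []
    0∙ p .at n = trans (coeff-∙ 0# p n) (zeroˡ _)

    shift-* : ∀ p r → (0# ∷ p) *ₚ r ≈ₚ 0# ∷ p *ₚ r
    shift-* p r = +ₚ-cong (0∙ r) (≈ₚ-refl {0# ∷ p *ₚ r})

    *ₚ-congˡ : ∀ p {r s} → r ≈ₚ s → p *ₚ r ≈ₚ p *ₚ s
    *ₚ-congˡ []      e = ≈ₚ-refl
    *ₚ-congˡ (a ∷ p) e = +ₚ-cong (∙-cong a e) (∷-cong refl (*ₚ-congˡ p e))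

    *ₚ-zeroʳ : ∀ p → p *ₚ [] ≈ₚ []
    *ₚ-zeroʳ []      = ≈ₚ-refl
    *ₚ-zeroʳ (a ∷ p) = ≈ₚ-trans (∷-cong refl (*ₚ-zeroʳ p)) 0∷[]

    *ₚ-∷ʳ : ∀ p b r → p *ₚ (b ∷ r) ≈ₚ b ∙ₚ p +ₚ (0# ∷ p *ₚ r)
    *ₚ-∷ʳ []      b r = ≈ₚ-sym 0∷[]
    *ₚ-∷ʳ (a ∷ p) b r = ∷-cong (+-congʳ (*-comm a b))
      (≈ₚ-trans (+ₚ-cong (≈ₚ-refl {a ∙ₚ r}) (*ₚ-∷ʳ p b r))
      (≈ₚ-trans (≈ₚ-sym (+ₚ-assoc (a ∙ₚ r) (b ∙ₚ p) (0# ∷ p *ₚ r)))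
      (≈ₚ-trans (+ₚ-cong (+ₚ-comm (a ∙ₚ r) (b ∙ₚ p)) (≈ₚ-refl {0# ∷ p *ₚ r}))
                (+ₚ-assoc (b ∙ₚ p) (a ∙ₚ r) (0# ∷ p *ₚ r)))))

    *ₚ-comm : ∀ p r → p *ₚ r ≈ₚ r *ₚ p
    *ₚ-comm []      r = ≈ₚ-sym (*ₚ-zeroʳ r)
    *ₚ-comm (a ∷ p) r = ≈ₚ-trans (+ₚ-cong (≈ₚ-refl {a ∙ₚ r}) (∷-cong refl (*ₚ-comm p r)))
                                 (≈ₚ-sym (*ₚ-∷ʳ r a p))

    *ₚ-cong : ∀ {p p′ r r′} → p ≈ₚ p′ → r ≈ₚ r′ → p *ₚ r ≈ₚ p′ *ₚ r′
    *ₚ-cong {p} {p′} {r} {r′} e f =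
      ≈ₚ-trans (*ₚ-congˡ p f)
      (≈ₚ-trans (*ₚ-comm p r′) (≈ₚ-trans (*ₚ-congˡ r′ e) (*ₚ-comm r′ p′)))

    *ₚ-distribˡ : ∀ p r s → p *ₚ (r +ₚ s) ≈ₚ p *ₚ r +ₚ p *ₚ s
    *ₚ-distribˡ []      r s = ≈ₚ-refl
    *ₚ-distribˡ (a ∷ p) r s =
      ≈ₚ-trans (+ₚ-cong (∙-distribˡ a r s)
                 (≈ₚ-trans (∷-cong refl (*ₚ-distribˡ p r s)) (shift-+ (p *ₚ r) (p *ₚ s))))
               (interchange (a ∙ₚ r) (a ∙ₚ s) (0# ∷ p *ₚ r) (0# ∷ p *ₚ s))

    *ₚ-distribʳ : ∀ p r s → (r +ₚ s) *ₚ p ≈ₚ r *ₚ p +ₚ s *ₚ p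
    *ₚ-distribʳ p r s = ≈ₚ-trans (*ₚ-comm (r +ₚ s) p)
      (≈ₚ-trans (*ₚ-distribˡ p r s) (+ₚ-cong (*ₚ-comm p r) (*ₚ-comm p s)))

    ∙-*ₚ : ∀ a p r → (a ∙ₚ p) *ₚ r ≈ₚ a ∙ₚ (p *ₚ r)
    ∙-*ₚ a []      r = ≈ₚ-refl
    ∙-*ₚ a (b ∷ p) r =
      ≈ₚ-trans (+ₚ-cong (∙-assoc a b r)
                 (≈ₚ-trans (∷-cong refl (∙-*ₚ a p r)) (≈ₚ-sym (∙-shift a (p *ₚ r)))))
               (≈ₚ-sym (∙-distribˡ a (b ∙ₚ r) (0# ∷ p *ₚ r)))

    *ₚ-assoc : ∀ p r s → (p *ₚ r) *ₚ s ≈ₚ p *ₚ (r *ₚ s)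
    *ₚ-assoc []      r s = ≈ₚ-refl
    *ₚ-assoc (a ∷ p) r s =
      ≈ₚ-trans (*ₚ-distribʳ s (a ∙ₚ r) (0# ∷ p *ₚ r))
        (+ₚ-cong (∙-*ₚ a r s) (≈ₚ-trans (shift-* (p *ₚ r) s) (∷-cong refl (*ₚ-assoc p r s))))

    *ₚ-identityˡ : ∀ p → 1ₚ *ₚ p ≈ₚ p
    *ₚ-identityˡ p = ≈ₚ-trans (+ₚ-cong (1∙ p) 0∷[]) (+ₚ-identityʳ p)
      where
      1∙ : ∀ p → 1# ∙ₚ p ≈ₚ p
      1∙ p .at n = trans (coeff-∙ 1# p n) (*-identityˡ _)

    *ₚ-identityʳ : ∀ p → p *ₚ 1ₚ ≈ₚ p
    *ₚ-identityʳ p = ≈ₚ-trans (*ₚ-comm p 1ₚ) (*ₚ-identityˡ p)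

    ¬¬-lem : ∀ {a} {A : Set a} → ¬ ¬ Dec A
    ¬¬-lem k = k (no λ a → k (yes a))

    shift-0 : ∀ {p} → 0# ∷ p ≈ₚ [] → p ≈ₚ []
    shift-0 e .at n = e .at (suc n)

    tail-≉ : ∀ {a p} → a ≈ 0# → ¬ a ∷ p ≈ₚ [] → ¬ p ≈ₚ []
    tail-≉ a≈0 ap≉0 p≈0 = ap≉0 (≈ₚ-trans (∷-cong a≈0 p≈0) 0∷[])

    *ₚ-noZeroDivisors : ∀ p r → ¬ p ≈ₚ [] → ¬ r ≈ₚ [] → ¬ p *ₚ r ≈ₚ []
    *ₚ-noZeroDivisors []      r p≉0 r≉0 e = p≉0 ≈ₚ-refl
    *ₚ-noZeroDivisors (a ∷ p) r p≉0 r≉0 e = ¬¬-lem λ where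
        (yes a≈0) → *ₚ-noZeroDivisors p r (tail-≉ a≈0 p≉0) r≉0
          (shift-0 (≈ₚ-trans (≈ₚ-sym (shift-* p r))
            (≈ₚ-trans (*ₚ-cong {0# ∷ p} (∷-cong (sym a≈0) ≈ₚ-refl) (≈ₚ-refl {r})) e)))
        (no a≉0) → lowest a≉0 r r≉0 e
      where
      lowest : ¬ a ≈ 0# → ∀ r → ¬ r ≈ₚ [] → ¬ (a ∷ p) *ₚ r ≈ₚ []
      lowest a≉0 []      r≉0 e = r≉0 ≈ₚ-refl
      lowest a≉0 (b ∷ r) r≉0 e = ¬¬-lem λ where
        (yes b≈0) → lowest a≉0 r (tail-≉ b≈0 r≉0)
          (shift-0 (≈ₚ-trans (≈ₚ-sym (+ₚ-cong (0∙ (a ∷ p)) (≈ₚ-refl {0# ∷ (a ∷ p) *ₚ r})))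
            (≈ₚ-trans (≈ₚ-sym (*ₚ-∷ʳ (a ∷ p) 0# r))
            (≈ₚ-trans (*ₚ-congˡ (a ∷ p) (∷-cong (sym b≈0) ≈ₚ-refl)) e))))
        (no b≉0) → noZeroDivisors a b a≉0 b≉0 (trans (sym (+-identityʳ (a * b))) (e .at zero))

  polynomialDomain : IntegralDomain c ℓ
  polynomialDomain = record
    { commutativeRing = record
      { Carrier = Poly ; _≈_ = _≈ₚ_ ; _+_ = _+ₚ_ ; _*_ = _*ₚ_ ; -_ = -ₚ_ ; 0# = 0ₚ ; 1# = 1ₚ
      ; isCommutativeRing = record
        { isRing = record
          { +-isAbelianGroup = record
            { isGroup = record
              { isMonoid = record
                { isSemigroup = record
                  { isMagma = record
                    { isEquivalence = record { refl = ≈ₚ-refl ; sym = ≈ₚ-sym ; trans = ≈ₚ-trans }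
                    ; ∙-cong = +ₚ-cong }
                  ; assoc = +ₚ-assoc }
                ; identity = (λ _ → ≈ₚ-refl) , +ₚ-identityʳ }
              ; inverse = -ₚ-inverseˡ , -ₚ-inverseʳ
              ; ⁻¹-cong = -ₚ-cong }
            ; comm = +ₚ-comm }
          ; *-cong = *ₚ-cong
          ; *-assoc = *ₚ-assoc
          ; *-identity = *ₚ-identityˡ , *ₚ-identityʳ
          ; distrib = *ₚ-distribˡ , *ₚ-distribʳ }
        ; *-comm = *ₚ-comm } }
    ; 1≉0 = λ e → 1≉0 (e .at 0)
    ; noZeroDivisors = *ₚ-noZeroDivisors
    ; ¬¬-stable = λ p r ¬¬e → mk≈ₚ λ n → ¬¬-stable (coeff p n) (coeff r n) λ ne → ¬¬e λ e → ne (e .at n)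
    }

module Fractions {c ℓ} (D : IntegralDomain c ℓ) where
  open IntegralDomain D hiding (zero)
  open RingProperties ring using (-‿distribˡ-*; x≈y⇒x∙y⁻¹≈ε; x∙y⁻¹≈ε⇒x≈y; [y-z]x≈yx-zx)
  open SetoidReasoning setoid
  open NatSolver commutativeSemiring using (solve; _:=_; _:+_; _:*_; con)

  infix 9 _/_⟨_⟩
  record Fraction : Set (c ⊔ ℓ) where
    constructor _/_⟨_⟩
    field
      num   : Carrier
      den   : Carrier
      den≉0 : ¬ den ≈ 0#
  open Fraction

  infix  4 _≈ᶠ_
  infixl 6 _+ᶠ_
  infixl 7 _*ᶠ_
  infix  8 -ᶠ_

  record _≈ᶠ_ (x y : Fraction) : Set ℓ where
    constructor mk≈ᶠ
    field cross : num x * den y ≈ num y * den x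
  open _≈ᶠ_ public

  fromDomain : Carrier → Fraction
  fromDomain a = a / 1# ⟨ 1≉0 ⟩

  0ᶠ 1ᶠ : Fraction
  0ᶠ = fromDomain 0#
  1ᶠ = fromDomain 1#

  _+ᶠ_ : Fraction → Fraction → Fraction
  (a / d ⟨ d≉0 ⟩) +ᶠ (b / e ⟨ e≉0 ⟩) = (a * e + b * d) / (d * e) ⟨ noZeroDivisors d e d≉0 e≉0 ⟩

  _*ᶠ_ : Fraction → Fraction → Fraction
  (a / d ⟨ d≉0 ⟩) *ᶠ (b / e ⟨ e≉0 ⟩) = (a * b) / (d * e) ⟨ noZeroDivisors d e d≉0 e≉0 ⟩

  -ᶠ_ : Fraction → Fraction
  -ᶠ (a / d ⟨ d≉0 ⟩) = (- a) / d ⟨ d≉0 ⟩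

  private
    cancelʳ : ∀ a b d → ¬ d ≈ 0# → a * d ≈ b * d → a ≈ b
    cancelʳ a b d d≉0 e = ¬¬-stable a b λ a≉b →
      noZeroDivisors (a - b) d (λ z → a≉b (x∙y⁻¹≈ε⇒x≈y a b z)) d≉0
        (trans ([y-z]x≈yx-zx d a b) (x≈y⇒x∙y⁻¹≈ε e))

    ≈ᶠ-trans : ∀ {x y z} → x ≈ᶠ y → y ≈ᶠ z → x ≈ᶠ z
    ≈ᶠ-trans {a / d ⟨ _ ⟩} {b / e ⟨ e≉0 ⟩} {g / f ⟨ _ ⟩} (mk≈ᶠ p) (mk≈ᶠ q) =
      mk≈ᶠ (cancelʳ (a * f) (g * d) e e≉0 (begin
        a * f * e  ≈⟨ solve 3 (λ a f e → a :* f :* e := a :* e :* f) refl a f e ⟩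
        a * e * f  ≈⟨ *-congʳ p ⟩
        b * d * f  ≈⟨ solve 3 (λ b d f → b :* d :* f := b :* f :* d) refl b d f ⟩
        b * f * d  ≈⟨ *-congʳ q ⟩
        g * e * d  ≈⟨ solve 3 (λ g e d → g :* e :* d := g :* d :* e) refl g e d ⟩
        g * d * e  ∎))

    +ᶠ-cong : ∀ {x x′ y y′} → x ≈ᶠ x′ → y ≈ᶠ y′ → x +ᶠ y ≈ᶠ x′ +ᶠ y′
    +ᶠ-cong {a / d ⟨ _ ⟩} {a′ / d′ ⟨ _ ⟩} {b / e ⟨ _ ⟩} {b′ / e′ ⟨ _ ⟩} (mk≈ᶠ p) (mk≈ᶠ q) = mk≈ᶠ (begin
      (a * e + b * d) * (d′ * e′)
        ≈⟨ solve 6 (λ a b d e d′ e′ → (a :* e :+ b :* d) :* (d′ :* e′) :=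
                      a :* d′ :* (e :* e′) :+ b :* e′ :* (d :* d′)) refl a b d e d′ e′ ⟩
      a * d′ * (e * e′) + b * e′ * (d * d′)
        ≈⟨ +-cong (*-congʳ p) (*-congʳ q) ⟩
      a′ * d * (e * e′) + b′ * e * (d * d′)
        ≈⟨ solve 6 (λ a′ b′ d e d′ e′ → a′ :* d :* (e :* e′) :+ b′ :* e :* (d :* d′) :=
                      (a′ :* e′ :+ b′ :* d′) :* (d :* e)) refl a′ b′ d e d′ e′ ⟩
      (a′ * e′ + b′ * d′) * (d * e) ∎)

    *ᶠ-cong : ∀ {x x′ y y′} → x ≈ᶠ x′ → y ≈ᶠ y′ → x *ᶠ y ≈ᶠ x′ *ᶠ y′
    *ᶠ-cong {a / d ⟨ _ ⟩} {a′ / d′ ⟨ _ ⟩} {b / e ⟨ _ ⟩} {b′ / e′ ⟨ _ ⟩} (mk≈ᶠ p) (mk≈ᶠ q) = mk≈ᶠ (begin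
      (a * b) * (d′ * e′)    ≈⟨ solve 4 (λ a b d e → (a :* b) :* (d :* e) := (a :* d) :* (b :* e)) refl a b d′ e′ ⟩
      (a * d′) * (b * e′)    ≈⟨ *-cong p q ⟩
      (a′ * d) * (b′ * e)    ≈⟨ solve 4 (λ a b d e → (a :* d) :* (b :* e) := (a :* b) :* (d :* e)) refl a′ b′ d e ⟩
      (a′ * b′) * (d * e)    ∎)

    -ᶠ-cong : ∀ {x y} → x ≈ᶠ y → -ᶠ x ≈ᶠ -ᶠ y
    -ᶠ-cong {x} {y} (mk≈ᶠ p) = mk≈ᶠ (begin
      - num x * den y    ≈⟨ -‿distribˡ-* (num x) (den y) ⟨
      - (num x * den y)  ≈⟨ -‿cong p ⟩
      - (num y * den x)  ≈⟨ -‿distribˡ-* (num y) (den x) ⟩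
      - num y * den x    ∎)

    +ᶠ-assoc : ∀ x y z → (x +ᶠ y) +ᶠ z ≈ᶠ x +ᶠ (y +ᶠ z)
    +ᶠ-assoc (a / d ⟨ _ ⟩) (b / e ⟨ _ ⟩) (g / f ⟨ _ ⟩) = mk≈ᶠ
      (solve 6 (λ a b g d e f → ((a :* e :+ b :* d) :* f :+ g :* (d :* e)) :* (d :* (e :* f)) :=
                (a :* (e :* f) :+ (b :* f :+ g :* e) :* d) :* ((d :* e) :* f)) refl a b g d e f)

    +ᶠ-comm : ∀ x y → x +ᶠ y ≈ᶠ y +ᶠ x
    +ᶠ-comm (a / d ⟨ _ ⟩) (b / e ⟨ _ ⟩) = mk≈ᶠ
      (solve 4 (λ a b d e → (a :* e :+ b :* d) :* (e :* d) := (b :* d :+ a :* e) :* (d :* e)) refl a b d e)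

    +ᶠ-identityˡ : ∀ x → 0ᶠ +ᶠ x ≈ᶠ x
    +ᶠ-identityˡ (a / d ⟨ _ ⟩) = mk≈ᶠ
      (solve 2 (λ a d → (con 0 :* d :+ a :* con 1) :* d := a :* (con 1 :* d)) refl a d)

    -ᶠ-inverseʳ : ∀ x → x +ᶠ -ᶠ x ≈ᶠ 0ᶠ
    -ᶠ-inverseʳ (a / d ⟨ _ ⟩) = mk≈ᶠ (begin
      (a * d + - a * d) * 1#   ≈⟨ *-identityʳ _ ⟩
      a * d + - a * d          ≈⟨ +-congˡ (-‿distribˡ-* a d) ⟨
      a * d + - (a * d)        ≈⟨ -‿inverseʳ (a * d) ⟩
      0#                       ≈⟨ zeroˡ (d * d) ⟨
      0# * (d * d)             ∎)

    *ᶠ-assoc : ∀ x y z → (x *ᶠ y) *ᶠ z ≈ᶠ x *ᶠ (y *ᶠ z)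
    *ᶠ-assoc (a / d ⟨ _ ⟩) (b / e ⟨ _ ⟩) (g / f ⟨ _ ⟩) = mk≈ᶠ
      (*-cong (*-assoc a b g) (sym (*-assoc d e f)))

    *ᶠ-comm : ∀ x y → x *ᶠ y ≈ᶠ y *ᶠ x
    *ᶠ-comm (a / d ⟨ _ ⟩) (b / e ⟨ _ ⟩) = mk≈ᶠ (*-cong (*-comm a b) (*-comm e d))

    *ᶠ-identityˡ : ∀ x → 1ᶠ *ᶠ x ≈ᶠ x
    *ᶠ-identityˡ (a / d ⟨ _ ⟩) = mk≈ᶠ (*-cong (*-identityˡ a) (sym (*-identityˡ d)))

    *ᶠ-distribˡ : ∀ x y z → x *ᶠ (y +ᶠ z) ≈ᶠ x *ᶠ y +ᶠ x *ᶠ z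
    *ᶠ-distribˡ (a / d ⟨ _ ⟩) (b / e ⟨ _ ⟩) (g / f ⟨ _ ⟩) = mk≈ᶠ
      (solve 6 (λ a b g d e f → (a :* (b :* f :+ g :* e)) :* ((d :* e) :* (d :* f)) :=
                ((a :* b) :* (d :* f) :+ (a :* g) :* (d :* e)) :* (d :* (e :* f))) refl a b g d e f)

    ≈ᶠ-isEquivalence : IsEquivalence _≈ᶠ_
    ≈ᶠ-isEquivalence = record
      { refl = mk≈ᶠ refl ; sym = λ (mk≈ᶠ p) → mk≈ᶠ (sym p) ; trans = ≈ᶠ-trans }

  fractionRing : CommutativeRing (c ⊔ ℓ) ℓ
  fractionRing = record
    { Carrier = Fraction ; _≈_ = _≈ᶠ_ ; _+_ = _+ᶠ_ ; _*_ = _*ᶠ_ ; -_ = -ᶠ_ ; 0# = 0ᶠ ; 1# = 1ᶠ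
    ; isCommutativeRing = record
      { isRing = record
        { +-isAbelianGroup = record
          { isGroup = record
            { isMonoid = record
              { isSemigroup = record
                { isMagma = record { isEquivalence = ≈ᶠ-isEquivalence ; ∙-cong = +ᶠ-cong }
                ; assoc = +ᶠ-assoc }
              ; identity = +ᶠ-identityˡ , λ x → ≈ᶠ-trans (+ᶠ-comm x 0ᶠ) (+ᶠ-identityˡ x) }
            ; inverse = (λ x → ≈ᶠ-trans (+ᶠ-comm (-ᶠ x) x) (-ᶠ-inverseʳ x)) , -ᶠ-inverseʳ
            ; ⁻¹-cong = -ᶠ-cong }
          ; comm = +ᶠ-comm }
        ; *-cong = *ᶠ-cong
        ; *-assoc = *ᶠ-assoc
        ; *-identity = *ᶠ-identityˡ , λ x → ≈ᶠ-trans (*ᶠ-comm x 1ᶠ) (*ᶠ-identityˡ x)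
        ; distrib = *ᶠ-distribˡ , λ x y z → ≈ᶠ-trans (*ᶠ-comm (y +ᶠ z) x)
            (≈ᶠ-trans (*ᶠ-distribˡ x y z) (+ᶠ-cong (*ᶠ-comm x y) (*ᶠ-comm x z))) }
      ; *-comm = *ᶠ-comm } }

module RationalFunctions where
  open RealField using (ℝ-commutativeRing; fromℚ-≉0; fromℚ-+; *ᴿ-noZeroDivisors; ≈ᴿ-stable)

  ℝ-domain : IntegralDomain 0ℓ 0ℓ
  ℝ-domain = record
    { commutativeRing = ℝ-commutativeRing
    ; 1≉0             = fromℚ-≉0 1ℚ (ℚₚ.positive⁻¹ 1ℚ)
    ; noZeroDivisors  = *ᴿ-noZeroDivisors
    ; ¬¬-stable       = ≈ᴿ-stable
    }

  open Polynomials ℝ-domain public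
  open Fractions polynomialDomain public

  private
    module ℝ-ring = CommutativeRing ℝ-commutativeRing

    1+1≉0 : ¬ 1ₚ +ₚ 1ₚ ≈ₚ 0ₚ
    1+1≉0 e = fromℚ-≉0 (1ℚ Rat.+ 1ℚ) (ℚₚ.positive⁻¹ (1ℚ Rat.+ 1ℚ))
      (ℝ-ring.trans (fromℚ-+ 1ℚ 1ℚ) (e .at 0))

    X+1≉0 : ¬ X +ₚ 1ₚ ≈ₚ 0ₚ
    X+1≉0 e = IntegralDomain.1≉0 ℝ-domain
      (ℝ-ring.trans (ℝ-ring.sym (ℝ-ring.+-identityˡ ℝ-ring.1#)) (e .at 0))

  ℝ⟨q⟩ : CommutativeRing 0ℓ 0ℓ
  ℝ⟨q⟩ = fractionRing

  RationalFunction : Set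
  RationalFunction = CommutativeRing.Carrier ℝ⟨q⟩

  q ½# 1/[q+1] : RationalFunction
  q       = fromDomain X
  ½#      = 1ₚ / (1ₚ +ₚ 1ₚ) ⟨ 1+1≉0 ⟩
  1/[q+1] = 1ₚ / (X +ₚ 1ₚ) ⟨ X+1≉0 ⟩

-- The coordinate in {1, …, n} represented by an element of Fin n.

⟦_⟧ : ∀ {n} → Fin n → ℕ
⟦ i ⟧ = suc (toℕ i)

InP : ∀ n → Fin n → Fin n → Set
InP n i j = n ℕ.+ 1 ℕ.≤ ⟦ i ⟧ ℕ.+ ⟦ j ⟧

InP? : ∀ n i j → Dec (InP n i j)
InP? n i j = n ℕ.+ 1 ℕₚ.≤? ⟦ i ⟧ ℕ.+ ⟦ j ⟧

record P (n : ℕ) : Set where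
  constructor pt
  field
    row col : Fin n
    .inP    : InP n row col
open P public

infix 4 _≼_ _≟ₚ_ _∈_ _∉_ _∈?_

_≼_ : ∀ {n} → P n → P n → Set
p ≼ p′ = row p Fin.≤ row p′ × col p Fin.≤ col p′

_≼?_ : ∀ {n} → Binary.Decidable (_≼_ {n})
p ≼? p′ = (row p Finₚ.≤? row p′) ×-dec (col p Finₚ.≤? col p′)

_≟ₚ_ : ∀ {n} → DecidableEquality (P n)
pt i j _ ≟ₚ pt i′ j′ _ = map′ (λ { (≡.refl , ≡.refl) → ≡.refl }) (λ { ≡.refl → ≡.refl , ≡.refl })
  ((i Finₚ.≟ i′) ×-dec (j Finₚ.≟ j′))

allP? : ∀ {n} {Q : Pred (P n) 0ℓ} → Decidable Q → Dec (∀ p → Q p)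
allP? {n} {Q} Q? = map′ join (λ f i j m → f (pt i j m))
  (Finₚ.all? λ i → Finₚ.all? λ j → at i j (InP? n i j))
  where
  join : (∀ i j → .(m : InP n i j) → Q (pt i j m)) → ∀ p → Q p
  join f (pt i j m) = f i j m

  at : ∀ i j → Dec (InP n i j) → Dec (.(m : InP n i j) → Q (pt i j m))
  at i j (yes m) = map′ (λ h _ → h) (λ h → h m) (Q? (pt i j m))
  at i j (no ¬m) = yes λ m → contradiction-irr m ¬m

-- As P n is finite, subsets are given by Boolean characteristic functions.

record OrderIdeal (n : ℕ) : Set where
  field
    member     : P n → Bool
    downClosed : ∀ {p p′} → p ≼ p′ → T (member p′) → T (member p)
open OrderIdeal public

_∈_ _∉_ : ∀ {n} → P n → OrderIdeal n → Set
p ∈ I = T (member I p)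
p ∉ I = ¬ p ∈ I

_∈?_ : ∀ {n} (p : P n) (I : OrderIdeal n) → Dec (p ∈ I)
p ∈? I = T? (member I p)

MinimalOutside : ∀ {n} → P n → OrderIdeal n → Set
MinimalOutside p I = p ∉ I × (∀ p′ → p′ ∉ I → p′ ≼ p → p′ ≡ p)

MaximalInside : ∀ {n} → P n → OrderIdeal n → Set
MaximalInside p I = p ∈ I × (∀ p′ → p′ ∈ I → p ≼ p′ → p′ ≡ p)

minimalOutside? : ∀ {n} (p : P n) I → Dec (MinimalOutside p I)
minimalOutside? p I =
  ¬? (p ∈? I) ×-dec allP? λ p′ → ¬? (p′ ∈? I) →-dec (p′ ≼? p) →-dec (p′ ≟ₚ p)

maximalInside? : ∀ {n} (p : P n) I → Dec (MaximalInside p I)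
maximalInside? p I =
  (p ∈? I) ×-dec allP? λ p′ → (p′ ∈? I) →-dec (p ≼? p′) →-dec (p′ ≟ₚ p)

module Toggleability {c ℓ} (K : CommutativeRing c ℓ) (q : CommutativeRing.Carrier K) where
  open CommutativeRing K
  open SemiringSum semiring using (sum-syntax)

  extendByZero : ∀ {n} → (P n → Carrier) → ∀ i j → Dec (InP n i j) → Carrier
  extendByZero f i j (yes m) = f (pt i j m)
  extendByZero f i j (no _)  = 0#

  sumP : ∀ {n} → (P n → Carrier) → Carrier
  sumP {n} f = ∑[ i < n ] ∑[ j < n ] extendByZero f i j (InP? n i j)

  sumPWhere : ∀ {n} {Q : Pred (P n) 0ℓ} → Decidable Q → (P n → Carrier) → Carrier
  sumPWhere Q? f = sumP λ p → if does (Q? p) then f p else 0#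

  T⁺ T⁻ T^q : ∀ {n} → P n → OrderIdeal n → Carrier
  T⁺  p I = if does (minimalOutside? p I) then 1# else 0#
  T⁻  p I = if does (maximalInside? p I) then 1# else 0#
  T^q p I = T⁺ p I - q * T⁻ p I

  infix 4 _≡^q_
  _≡^q_ : ∀ {n} → (f g : OrderIdeal n → Carrier) → Set (c ⊔ ℓ)
  _≡^q_ {n} f g = Σ[ coef ∈ (P n → Carrier) ]
    ∀ (I : OrderIdeal n) → f I - g I ≈ sumP (λ p → coef p * T^q p I)

  R̄ : ∀ {n} → Fin n → OrderIdeal n → Carrier
  R̄ {n} i I =
      sumPWhere (λ p → (row p Finₚ.≟ i) ×-dec (n ℕ.+ 1 ℕ.∸ ⟦ i ⟧ ℕₚ.≤? ⟦ col p ⟧)) (λ p → T⁻ p I)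
    + sumPWhere (λ p → (⟦ i ⟧ ℕₚ.≤? ⟦ row p ⟧) ×-dec (⟦ col p ⟧ ℕₚ.≟ n ℕ.+ 1 ℕ.∸ ⟦ i ⟧)) (λ p → T⁻ p I)

open RationalFunctions public using (RationalFunction; ℝ⟨q⟩; q; ½#; 1/[q+1])
open CommutativeRing ℝ⟨q⟩ public using (_*_; -_; 0#; 1#)
open SemiringExp (CommutativeRing.semiring ℝ⟨q⟩) public using (_^_)
open SemiringSum (CommutativeRing.semiring ℝ⟨q⟩) public using (sum; sum-syntax)
open Toggleability ℝ⟨q⟩ q public

-- In the alternating sum of the rooks T⁻ at p = (a , b) has the coefficient w(a,b), where
-- w(a,b) = (-1)^(n+b) - (-1)^a.  Let χ be the indicator of the order ideal, extended by 1 below P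
-- and by 0 beyond it.  Then
--   T⁺ = χ(a-1,b) χ(a,b-1) - χ(a,b),
--   T⁻ = χ(a,b) - χ(a+1,b) - χ(a,b+1) + χ(a+1,b) χ(a,b+1).
-- As w(a+1,b+1) = - w(a,b) and w(a+1,b) = - w(a,b+1), in the sum of w (T⁺ + T⁻) the products and the
-- linear terms cancel up to a boundary contribution independent of the ideal: 2 for odd n and 0 for even n.
-- Hence c w with c = - 1 / (2 (q + 1)) are the coefficients of the toggleability statistics T^q.

module Submission where

open import Algebra.Bundles using (CommutativeRing)
import Algebra.Properties.Ring as RingProperties
import Algebra.Properties.Semiring.Exp as SemiringExp
import Algebra.Properties.Semiring.Sum as SemiringSum
import Algebra.Solver.Ring.NaturalCoefficients.Default as NatSolver
open import Data.Bool.Base using (Bool; if_then_else_; not; _∧_)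
open import Data.Fin.Base as Fin using (Fin; toℕ; fromℕ<; opposite)
import Data.Fin.Properties as Finₚ
open import Data.Nat.Base as ℕ using (ℕ; zero; suc; s≤s; _≤_)
import Data.Nat.Properties as ℕₚ
open import Data.Nat.Divisibility using (_∣_; _∤_; _∣0; ∣-refl; ∣⇒≤; ∣m+n∣m⇒∣n; ∣m∣n⇒∣m+n)
open import Data.Product.Base using (_×_; _,_; proj₁; proj₂)
open import Function.Base using (const; _∘_)
open import Function.Bundles using (_⇔_; mk⇔)
open import Relation.Binary.PropositionalEquality as ≡ using (_≡_)
import Relation.Binary.Reasoning.Setoid as SetoidReasoning
open import Relation.Nullary using (¬_; Dec; yes; no; does; contradiction)
open import Relation.Nullary.Decidable
  using (¬?; _×-dec_; _→-dec_; decidable-stable; recompute; does-⇔; dec-true; dec-false)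
open import Defs using
  ( P; pt; row; col; InP; InP?; ⟦_⟧; _∈_; _∈?_; allP?; OrderIdeal; downClosed
  ; MinimalOutside; MaximalInside; minimalOutside?; maximalInside?; module Toggleability
  ; IntegralDomain; module IntegralDomain; module Fractions; module RationalFunctions )

-- Order ideals as down-sets of a square grid.

rank≥0 : ∀ {n} (p : P n) → suc n ≤ ⟦ row p ⟧ ℕ.+ ⟦ col p ⟧
rank≥0 {n} (pt i j m) =
  -- The field `inP` is irrelevant; as the inequality is decidable, `recompute` makes it usable.
  ≡.subst (_≤ ⟦ i ⟧ ℕ.+ ⟦ j ⟧) (ℕₚ.+-comm n 1) (recompute (InP? n i j) m)

P-≡ : ∀ {n} {p p′ : P n} → row p ≡ row p′ → col p ≡ col p′ → p ≡ p′
P-≡ ≡.refl ≡.refl = ≡.refl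

-- I extended to a down-set of {0, …, n}²: every position below P n is inside.

Inside : ∀ {n} → OrderIdeal n → ℕ → ℕ → Set
Inside {n} I a b = a ≤ n × b ≤ n × (∀ (p : P n) → ⟦ row p ⟧ ≤ a → ⟦ col p ⟧ ≤ b → p ∈ I)

inside? : ∀ {n} (I : OrderIdeal n) a b → Dec (Inside I a b)
inside? {n} I a b = (a ℕₚ.≤? n) ×-dec (b ℕₚ.≤? n) ×-dec
  allP? λ p → (⟦ row p ⟧ ℕₚ.≤? a) →-dec (⟦ col p ⟧ ℕₚ.≤? b) →-dec (p ∈? I)

module _ {n} (I : OrderIdeal n) where

  Inside-mono : ∀ {a a′ b b′} → a ≤ a′ → b ≤ b′ → Inside I a′ b′ → Inside I a b
  Inside-mono a≤ b≤ (a′≤n , b′≤n , h) = ℕₚ.≤-trans a≤ a′≤n , ℕₚ.≤-trans b≤ b′≤n ,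
    λ p r c → h p (ℕₚ.≤-trans r a≤) (ℕₚ.≤-trans c b≤)

  -- Every element of `P n` has coordinate sum at least `n + 1`, so the condition on elements is
  -- vacuous here.
  Inside-below : ∀ {a b} → a ℕ.+ b ≤ n → Inside I a b
  Inside-below {a} {b} a+b≤n = ℕₚ.m+n≤o⇒m≤o a a+b≤n , ℕₚ.m+n≤o⇒n≤o a a+b≤n ,
    λ p r c → contradiction (ℕₚ.≤-trans (rank≥0 p) (ℕₚ.≤-trans (ℕₚ.+-mono-≤ r c) a+b≤n))
                            ℕₚ.1+n≰n

  ∈⇒Inside : ∀ {p} → p ∈ I → Inside I ⟦ row p ⟧ ⟦ col p ⟧
  ∈⇒Inside {p} p∈I = Finₚ.toℕ<n (row p) , Finₚ.toℕ<n (col p) ,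
    λ p′ r c → downClosed I {p′} {p} (ℕ.s≤s⁻¹ r , ℕ.s≤s⁻¹ c) p∈I

  Inside⇒∈ : ∀ {p} → Inside I ⟦ row p ⟧ ⟦ col p ⟧ → p ∈ I
  Inside⇒∈ {p} (_ , _ , h) = h p ℕₚ.≤-refl ℕₚ.≤-refl

  -- An element strictly below `p` lies weakly below its left or its lower neighbour. Hence
  -- minimality of `p` says exactly that these two positions are inside; they may lie off `P n`,
  -- where the extension makes them inside anyway.
  minimalOutside⇔ : ∀ p → MinimalOutside p I ⇔
    ((¬ Inside I ⟦ row p ⟧ ⟦ col p ⟧) × Inside I (toℕ (row p)) ⟦ col p ⟧ × Inside I ⟦ row p ⟧ (toℕ (col p)))
  minimalOutside⇔ p = mk⇔ to from
    where
    to : MinimalOutside p I → _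
    to (p∉I , minimal) = (λ x → p∉I (Inside⇒∈ x)) ,
      (ℕₚ.<⇒≤ (Finₚ.toℕ<n (row p)) , Finₚ.toℕ<n (col p) , λ p′ r c → decidable-stable (p′ ∈? I) λ p′∉I →
        ℕₚ.<-irrefl (≡.cong (toℕ ∘ row) (minimal p′ p′∉I (ℕₚ.<⇒≤ r , ℕ.s≤s⁻¹ c))) r) ,
      (Finₚ.toℕ<n (row p) , ℕₚ.<⇒≤ (Finₚ.toℕ<n (col p)) , λ p′ r c → decidable-stable (p′ ∈? I) λ p′∉I →
        ℕₚ.<-irrefl (≡.cong (toℕ ∘ col) (minimal p′ p′∉I (ℕ.s≤s⁻¹ r , ℕₚ.<⇒≤ c))) c)

    from : _ → MinimalOutside p I
    from (out , (_ , _ , left) , (_ , _ , down)) = (λ p∈I → out (∈⇒Inside p∈I)) , λ p′ p′∉I (r , c) →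
      P-≡ (Finₚ.toℕ-injective (ℕₚ.≤-antisym r (ℕₚ.≮⇒≥ λ lt → p′∉I (left p′ lt (s≤s c)))))
          (Finₚ.toℕ-injective (ℕₚ.≤-antisym c (ℕₚ.≮⇒≥ λ lt → p′∉I (down p′ (s≤s r) lt))))

  -- Going up or right never leaves `P n` except across the border of the grid. The bounds by `n` in
  -- `Inside` put positions past that border outside; within it, an inside neighbour is an element
  -- `p⁺` of the ideal above `p`, against maximality.
  maximalInside⇔ : ∀ p → MaximalInside p I ⇔
    (Inside I ⟦ row p ⟧ ⟦ col p ⟧ × (¬ Inside I (suc ⟦ row p ⟧) ⟦ col p ⟧) × (¬ Inside I ⟦ row p ⟧ (suc ⟦ col p ⟧)))
  maximalInside⇔ p@(pt i j m) = mk⇔ to from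
    where
    to : MaximalInside p I → _
    to (p∈I , maximal) = ∈⇒Inside p∈I , noRight , noUp
      where
      noRight : ¬ Inside I (suc ⟦ i ⟧) ⟦ j ⟧
      noRight (a≤n , _ , h) = ℕₚ.1+n≢n (≡.trans (≡.sym (Finₚ.toℕ-fromℕ< a≤n))
        (≡.cong (toℕ ∘ row) (maximal p⁺ (h p⁺ (s≤s (ℕₚ.≤-reflexive (Finₚ.toℕ-fromℕ< a≤n))) ℕₚ.≤-refl) (i≤ , ℕₚ.≤-refl))))
        where
        i≤ : toℕ i ≤ toℕ (fromℕ< a≤n)
        i≤ = ℕₚ.≤-trans (ℕₚ.n≤1+n _) (ℕₚ.≤-reflexive (≡.sym (Finₚ.toℕ-fromℕ< a≤n)))
        p⁺ : P n
        p⁺ = pt (fromℕ< a≤n) j (ℕₚ.≤-trans m (s≤s (ℕₚ.+-monoˡ-≤ ⟦ j ⟧ i≤)))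

      noUp : ¬ Inside I ⟦ i ⟧ (suc ⟦ j ⟧)
      noUp (_ , b≤n , h) = ℕₚ.1+n≢n (≡.trans (≡.sym (Finₚ.toℕ-fromℕ< b≤n))
        (≡.cong (toℕ ∘ col) (maximal p⁺ (h p⁺ ℕₚ.≤-refl (s≤s (ℕₚ.≤-reflexive (Finₚ.toℕ-fromℕ< b≤n)))) (ℕₚ.≤-refl , j≤))))
        where
        j≤ : toℕ j ≤ toℕ (fromℕ< b≤n)
        j≤ = ℕₚ.≤-trans (ℕₚ.n≤1+n _) (ℕₚ.≤-reflexive (≡.sym (Finₚ.toℕ-fromℕ< b≤n)))
        p⁺ : P n
        p⁺ = pt i (fromℕ< b≤n) (ℕₚ.≤-trans m (ℕₚ.+-monoʳ-≤ ⟦ i ⟧ (s≤s j≤)))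

    from : _ → MaximalInside p I
    from (inside , noRight , noUp) = Inside⇒∈ inside , λ p′ p′∈I (r , c) → P-≡
      (Finₚ.toℕ-injective (ℕₚ.≤-antisym (ℕₚ.≮⇒≥ λ lt → noRight (Inside-mono (s≤s lt) (s≤s c) (∈⇒Inside {p′} p′∈I))) r))
      (Finₚ.toℕ-injective (ℕₚ.≤-antisym (ℕₚ.≮⇒≥ λ lt → noUp (Inside-mono (s≤s r) (s≤s lt) (∈⇒Inside {p′} p′∈I))) c))

-- One interface for both constants of the theorem: `x = 1` gives one half and `x = q` gives the
-- reciprocal of `q + 1`. The main argument then runs over any commutative ring.
record Reciprocal-suc {c ℓ} (K : CommutativeRing c ℓ) (x y : CommutativeRing.Carrier K) : Set ℓ where
  open CommutativeRing K
  field inverse : y * (x + 1#) ≈ 1#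

module AlternatingRooks {c ℓ} (K : CommutativeRing c ℓ) (q : CommutativeRing.Carrier K) where

  open CommutativeRing K
  open Toggleability K q
  open RingProperties ring
  open SemiringExp semiring using (_^_)
  open SemiringSum semiring using
    (sum; sum-syntax; sum-cong-≋; sum-replicate-zero; ∑-distrib-+; ∑-comm; *-distribˡ-sum)
  open SetoidReasoning setoid
  open NatSolver commutativeSemiring using (solve; _:=_; _:+_; _:*_; con)

  -- Finite sums over an initial segment.

  sum-0 : ∀ {n} {f : Fin n → Carrier} → (∀ i → f i ≈ 0#) → sum f ≈ 0#
  sum-0 {n} f≈0 = trans (sum-cong-≋ f≈0) (sum-replicate-zero n)

  -- Both sides are the sum of `F` over 0, ..., n; no subtraction is involved.
  sum-telescope : ∀ n (F : ℕ → Carrier) →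
    ∑[ i < n ] F (suc (toℕ i)) + F 0 ≈ ∑[ i < n ] F (toℕ i) + F n
  sum-telescope zero    F = refl
  sum-telescope (suc n) F = begin
    F 1 + ∑[ i < n ] F (suc (suc (toℕ i))) + F 0
      ≈⟨ solve 3 (λ a b c → a :+ b :+ c := c :+ (b :+ a)) refl _ _ _ ⟩
    F 0 + (∑[ i < n ] F (suc (suc (toℕ i))) + F 1)  ≈⟨ +-congˡ (sum-telescope n (F ∘ suc)) ⟩
    F 0 + (∑[ i < n ] F (suc (toℕ i)) + F (suc n))  ≈⟨ +-assoc _ _ _ ⟨
    F 0 + ∑[ i < n ] F (suc (toℕ i)) + F (suc n)    ∎

  sum-shift : ∀ n (F : ℕ → Carrier) → F n ≈ 0# → ∑[ i < n ] F (suc (toℕ i)) + F 0 ≈ ∑[ i < n ] F (toℕ i)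
  sum-shift n F Fn≈0 = trans (sum-telescope n F) (trans (+-congˡ Fn≈0) (+-identityʳ _))

  sum-select : ∀ {n p} {Q : Fin n → Set p} (Q? : ∀ i → Dec (Q i)) i₀ → Q i₀ → (∀ i → Q i → i ≡ i₀) →
    ∀ (f : Fin n → Carrier) x → ∑[ i < n ] (f i * (if does (Q? i) then x else 0#)) ≈ f i₀ * x
  sum-select {suc n} Q? Fin.zero q₀ unique f x with Q? Fin.zero
  ... | no ¬q₀ = contradiction q₀ ¬q₀
  ... | yes _  = trans (+-congˡ (sum-0 vanish)) (+-identityʳ _)
    where
    vanish : ∀ i → f (Fin.suc i) * (if does (Q? (Fin.suc i)) then x else 0#) ≈ 0#
    vanish i with Q? (Fin.suc i)
    ... | no _ = zeroʳ _
    ... | yes qᵢ with () ← unique (Fin.suc i) qᵢ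
  sum-select {suc n} Q? (Fin.suc i₀) q₀ unique f x with Q? Fin.zero
  ... | yes q₀′ with () ← unique Fin.zero q₀′
  ... | no _ = trans (+-cong (zeroʳ _)
                 (sum-select (Q? ∘ Fin.suc) i₀ q₀ (λ i → Finₚ.suc-injective ∘ unique (Fin.suc i)) (f ∘ Fin.suc) x))
                 (+-identityˡ _)

  -- Alternating signs and the weights.

  ε : ℕ → Carrier
  ε k = (- 1#) ^ k

  ε-suc : ∀ k → ε (suc k) ≈ - ε k
  ε-suc k = -1*x≈-x (ε k)

  ε-suc² : ∀ k → ε (suc (suc k)) ≈ ε k
  ε-suc² k = trans (ε-suc (suc k)) (trans (-‿cong (ε-suc k)) (-‿involutive _))

  -ε-suc : ∀ k → - ε (suc k) ≈ ε k
  -ε-suc k = trans (-‿cong (ε-suc k)) (-‿involutive _)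

  ε0+ε1≈0 : ε 0 + ε 1 ≈ 0#
  ε0+ε1≈0 = trans (+-congˡ (ε-suc 0)) (-‿inverseʳ (ε 0))

  -- Induction in steps of two: the first two signs cancel and the remaining ones repeat with period
  -- two.
  sum-ε : ∀ n → (2 ∣ n → ∑[ i < n ] ε (toℕ i) ≈ 0#) × (2 ∤ n → ∑[ i < n ] ε (toℕ i) ≈ 1#)
  sum-ε 0 = const refl , λ 2∤0 → contradiction (2 ∣0) 2∤0
  sum-ε 1 = (λ 2∣1 → contradiction (∣⇒≤ 2∣1) λ { (s≤s ()) }) , const (+-identityʳ 1#)
  sum-ε (suc (suc n)) =
    (λ 2∣n+2 → trans step (proj₁ (sum-ε n) (∣m+n∣m⇒∣n 2∣n+2 ∣-refl))) ,
    (λ 2∤n+2 → trans step (proj₂ (sum-ε n) (2∤n+2 ∘ ∣m∣n⇒∣m+n ∣-refl)))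
    where
    step : ∑[ i < suc (suc n) ] ε (toℕ i) ≈ ∑[ i < n ] ε (toℕ i)
    step = begin
      ε 0 + (ε 1 + ∑[ i < n ] ε (suc (suc (toℕ i))))  ≈⟨ +-assoc _ _ _ ⟨
      ε 0 + ε 1 + ∑[ i < n ] ε (suc (suc (toℕ i)))
        ≈⟨ +-cong ε0+ε1≈0 (sum-cong-≋ {n} λ i → ε-suc² (toℕ i)) ⟩
      0# + ∑[ i < n ] ε (toℕ i)                       ≈⟨ +-identityˡ _ ⟩
      ∑[ i < n ] ε (toℕ i)                            ∎

  ε-+2* : ∀ m k → ε (m ℕ.+ (k ℕ.+ k)) ≈ ε m
  ε-+2* m zero    = reflexive (≡.cong ε (ℕₚ.+-identityʳ m))
  ε-+2* m (suc k) = begin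
    ε (m ℕ.+ suc (k ℕ.+ suc k))  ≡⟨ ≡.cong ε (≡.trans (ℕₚ.+-suc m _) (≡.cong suc (≡.trans (≡.cong (m ℕ.+_) (ℕₚ.+-suc k k)) (ℕₚ.+-suc m _)))) ⟩
    ε (suc (suc (m ℕ.+ (k ℕ.+ k))))  ≈⟨ ε-suc² (m ℕ.+ (k ℕ.+ k)) ⟩
    ε (m ℕ.+ (k ℕ.+ k))          ≈⟨ ε-+2* m k ⟩
    ε m ∎

  weight : ℕ → ℕ → ℕ → Carrier
  weight n a b = ε (n ℕ.+ b) - ε a

  module _ (n : ℕ) where

    private
      w : ℕ → ℕ → Carrier
      w = weight n

      ε-col : ∀ b → ε (n ℕ.+ suc b) ≈ - ε (n ℕ.+ b)
      ε-col b = trans (reflexive (≡.cong ε (ℕₚ.+-suc n b))) (ε-suc (n ℕ.+ b))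

    weight-diagonal : ∀ a b → w (suc a) (suc b) ≈ - w a b
    weight-diagonal a b = trans (+-cong (ε-col b) (-‿cong (ε-suc a))) (-‿+-comm _ _)

    weight-antidiagonal : ∀ a b → w (suc a) b ≈ - w a (suc b)
    weight-antidiagonal a b = begin
      ε (n ℕ.+ b) - ε (suc a)        ≈⟨ +-congˡ (-‿cong (ε-suc a)) ⟩
      ε (n ℕ.+ b) - - ε a            ≈⟨ +-congʳ (-‿involutive _) ⟨
      - - ε (n ℕ.+ b) - - ε a        ≈⟨ -‿+-comm _ _ ⟩
      - (- ε (n ℕ.+ b) - ε a)        ≈⟨ -‿cong (+-congʳ (ε-col b)) ⟨
      - (ε (n ℕ.+ suc b) - ε a)      ∎

    -- On the line just below `P n` the exponent `n + b` is `a + 2b`, so the two signs agree.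
    weight-0 : ∀ a b → a ℕ.+ b ≡ n → w a b ≈ 0#
    weight-0 a b ≡.refl = x≈y⇒x∙y⁻¹≈ε
      (trans (reflexive (≡.cong ε (ℕₚ.+-assoc a b b))) (ε-+2* a b))

    -- The signs belonging to columns 0 and 1 are opposite, so only the row sign survives, twice.
    -- This is the boundary value left by each row.
    weight-border : ∀ a → w (suc a) 1 + w (suc a) 0 ≈ ε a + ε a
    weight-border a = begin
      (ε (n ℕ.+ 1) - ε (suc a)) + (ε (n ℕ.+ 0) - ε (suc a))
        ≈⟨ +-cong (+-cong (ε-col 0) (-ε-suc a)) (+-congˡ (-ε-suc a)) ⟩
      -- The solver works in commutative semirings, so `- x` enters as an independent variable;
      -- later uses treat negatives the same way.
      (- x + ε a) + (x + ε a)   ≈⟨ solve 3 (λ x⁻ x y → (x⁻ :+ y) :+ (x :+ y) := (x⁻ :+ x) :+ (y :+ y)) refl (- x) x (ε a) ⟩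
      (- x + x) + (ε a + ε a)   ≈⟨ +-congʳ (-‿inverseˡ x) ⟩
      0# + (ε a + ε a)          ≈⟨ +-identityˡ _ ⟩
      ε a + ε a                 ∎
      where x = ε (n ℕ.+ 0)

  -- Inclusion-exclusion for indicators.

  indicator : Bool → Carrier
  indicator b = if b then 1# else 0#

  -- The case where `Y` and `Z` both hold splits according to `X`, and `X` can hold only in that
  -- case.
  indicator-outside : ∀ {x y z} {X : Set x} {Y : Set y} {Z : Set z} (x? : Dec X) (y? : Dec Y) (z? : Dec Z) →
    (X → Y) → (X → Z) →
    indicator (not (does x?) ∧ (does y? ∧ does z?)) + indicator (does x?) ≈
    indicator (does y?) * indicator (does z?)
  indicator-outside (yes x) (no ¬y) _       X→Y X→Z = contradiction (X→Y x) ¬y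
  indicator-outside (yes x) (yes _) (no ¬z) X→Y X→Z = contradiction (X→Z x) ¬z
  indicator-outside (yes _) (yes _) (yes _) _ _ = trans (+-identityˡ _) (sym (*-identityˡ _))
  indicator-outside (no _)  (no _)  _       _ _ = trans (+-identityˡ _) (sym (zeroˡ _))
  indicator-outside (no _)  (yes _) (no _)  _ _ = trans (+-identityˡ _) (sym (zeroʳ _))
  indicator-outside (no _)  (yes _) (yes _) _ _ = trans (+-identityʳ _) (sym (*-identityˡ _))

  -- Expanding `x (1 - y) (1 - z)` gives `x - y - z + z y`, because `x` absorbs into `y` and `z`;
  -- the negative terms are moved to the left.
  indicator-inside : ∀ {x y z} {X : Set x} {Y : Set y} {Z : Set z} (x? : Dec X) (y? : Dec Y) (z? : Dec Z) →
    (Y → X) → (Z → X) →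
    indicator (does x? ∧ (not (does y?) ∧ not (does z?))) + (indicator (does y?) + indicator (does z?)) ≈
    indicator (does x?) + indicator (does z?) * indicator (does y?)
  indicator-inside (no ¬x) (yes y) _       Y→X Z→X = contradiction (Y→X y) ¬x
  indicator-inside (no ¬x) (no _)  (yes z) Y→X Z→X = contradiction (Z→X z) ¬x
  indicator-inside (no _)  (no _)  (no _)  _ _ = +-congˡ (trans (+-identityˡ _) (sym (zeroˡ _)))
  indicator-inside (yes _) (yes _) (yes _) _ _ = trans (+-identityˡ _) (+-congˡ (sym (*-identityˡ _)))
  indicator-inside (yes _) (yes _) (no _)  _ _ = solve 0 (con 0 :+ (con 1 :+ con 0) := con 1 :+ con 0 :* con 1) refl
  indicator-inside (yes _) (no _)  (yes _) _ _ = solve 0 (con 0 :+ (con 0 :+ con 1) := con 1 :+ con 1 :* con 0) refl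
  indicator-inside (yes _) (no _)  (no _)  _ _ = solve 0 (con 1 :+ (con 0 :+ con 0) := con 1 :+ con 0 :* con 0) refl

  -- The weighted toggles of a fixed ideal: telescoping over the grid.

  module _ {n} (I : OrderIdeal n) where

    private
      w : ℕ → ℕ → Carrier
      w = weight n

    χ : ℕ → ℕ → Carrier
    χ a b = indicator (does (inside? I a b))

    χ≈1 : ∀ {a b} → a ℕ.+ b ≤ n → χ a b ≈ 1#
    χ≈1 {a} {b} le = reflexive (≡.cong indicator (dec-true (inside? I a b) (Inside-below I le)))

    χ≈0 : ∀ {a b} → ¬ Inside I a b → χ a b ≈ 0#
    χ≈0 {a} {b} outside = reflexive (≡.cong indicator (dec-false (inside? I a b) outside))

    χ-row≈0 : ∀ b → χ (suc n) b ≈ 0#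
    χ-row≈0 b = χ≈0 {suc n} {b} λ (1+n≤n , _) → ℕₚ.1+n≰n 1+n≤n

    χ-col≈0 : ∀ a → χ a (suc n) ≈ 0#
    χ-col≈0 a = χ≈0 {a} {suc n} λ (_ , 1+n≤n , _) → ℕₚ.1+n≰n 1+n≤n

    -- Off P n the weight vanishes just where the indicator may differ from 1.

    weight-absorb : ∀ {a b a′ b′} → a ℕ.+ b ≤ n → a′ ℕ.+ b′ ≡ suc (a ℕ.+ b) → w a b * χ a′ b′ ≈ w a b
    weight-absorb {a} {b} {a′} {b′} le eq with a ℕ.+ b ℕₚ.≟ n
    ... | yes a+b≡n = trans (*-congʳ w≈0) (trans (zeroˡ _) (sym w≈0))
      where w≈0 = weight-0 n a b a+b≡n
    ... | no a+b≢n  = trans (*-congˡ (χ≈1 {a′} {b′} (≡.subst (_≤ n) (≡.sym eq) (ℕₚ.≤∧≢⇒< le a+b≢n)))) (*-identityʳ _)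

    weight-absorb-row : ∀ {a b} → a ℕ.+ b ≤ n → w a b * χ (suc a) b ≈ w a b
    weight-absorb-row {a} {b} le = weight-absorb {a} {b} {suc a} {b} le ≡.refl

    weight-absorb-col : ∀ {a b} → a ℕ.+ b ≤ n → w a b * χ a (suc b) ≈ w a b
    weight-absorb-col {a} {b} le = weight-absorb {a} {b} {a} {suc b} le (ℕₚ.+-suc a b)

    module _ (p : P n) where

      T⁺-χ : T⁺ p I + χ ⟦ row p ⟧ ⟦ col p ⟧ ≈ χ (toℕ (row p)) ⟦ col p ⟧ * χ ⟦ row p ⟧ (toℕ (col p))
      T⁺-χ = trans
        (+-congʳ (reflexive (≡.cong indicator
          -- `does` of the combined decision computes to the Boolean expression in
          -- `indicator-outside`.
          (does-⇔ (minimalOutside⇔ I p) (minimalOutside? p I) (¬? here ×-dec left ×-dec below)))))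
        (indicator-outside here left below
          (Inside-mono I (ℕₚ.n≤1+n _) ℕₚ.≤-refl) (Inside-mono I ℕₚ.≤-refl (ℕₚ.n≤1+n _)))
        where
        here  = inside? I ⟦ row p ⟧ ⟦ col p ⟧
        left  = inside? I (toℕ (row p)) ⟦ col p ⟧
        below = inside? I ⟦ row p ⟧ (toℕ (col p))

      T⁻-χ : T⁻ p I + (χ (suc ⟦ row p ⟧) ⟦ col p ⟧ + χ ⟦ row p ⟧ (suc ⟦ col p ⟧)) ≈
        χ ⟦ row p ⟧ ⟦ col p ⟧ + χ ⟦ row p ⟧ (suc ⟦ col p ⟧) * χ (suc ⟦ row p ⟧) ⟦ col p ⟧
      T⁻-χ = trans
        (+-congʳ (reflexive (≡.cong indicator
          (does-⇔ (maximalInside⇔ I p) (maximalInside? p I) (here ×-dec ¬? right ×-dec ¬? above)))))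
        (indicator-inside here right above
          (Inside-mono I (ℕₚ.n≤1+n _) ℕₚ.≤-refl) (Inside-mono I ℕₚ.≤-refl (ℕₚ.n≤1+n _)))
        where
        here  = inside? I ⟦ row p ⟧ ⟦ col p ⟧
        right = inside? I (suc ⟦ row p ⟧) ⟦ col p ⟧
        above = inside? I ⟦ row p ⟧ (suc ⟦ col p ⟧)

    -- With H for the products and L for the linear terms, the contribution of a cell is D of its row
    -- plus D′ of the next row (D+D′, cell-P), whereas D plus D′ of one row telescopes (sum-row).

    H L : ℕ → ℕ → Carrier
    H i j = w (suc i) (suc j) * (χ i (suc j) * χ (suc i) j)
    L i j = w (suc i) j * χ (suc i) (suc j)

    D D′ : ℕ → ℕ → Carrier
    D  i j = H i j - L i (suc j)
    D′ i j = L i j - H i (suc j)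

    D+D′ : ∀ i j → D i j + D′ (suc i) j ≈
      (w (suc i) (suc j) * (χ i (suc j) * χ (suc i) j) + - w (suc i) (suc j) * χ (suc i) (suc (suc j))) +
      (- w (suc i) (suc j) * χ (suc (suc i)) (suc j) +
        w (suc i) (suc j) * (χ (suc i) (suc (suc j)) * χ (suc (suc i)) (suc j)))
    -- The terms of `D′ (suc i) j` carry weights of the next row. The antidiagonal rule for the
    -- linear term and the diagonal rule for the product turn both weights into
    -- `- w (suc i) (suc j)`.
    D+D′ i j = +-cong (+-congˡ (-‿distribˡ-* _ _)) (+-cong
      (*-congʳ (weight-antidiagonal n (suc i) j))
      (trans (-‿cong (trans (*-congʳ (weight-diagonal n (suc i) (suc j))) (sym (-‿distribˡ-* _ _))))
             (-‿involutive _)))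

    cell-P : ∀ p → w ⟦ row p ⟧ ⟦ col p ⟧ * (T⁺ p I + T⁻ p I) ≈
      D (toℕ (row p)) (toℕ (col p)) + D′ (suc (toℕ (row p))) (toℕ (col p))
    cell-P p = sym (begin
      D i j + D′ (suc i) j                            ≈⟨ D+D′ i j ⟩
      (W * π + - W * z) + (- W * y + W * (z * y))
        ≈⟨ solve 5 (λ a a⁻ p z y → (a :* p :+ a⁻ :* z) :+ (a⁻ :* y :+ a :* (z :* y)) :=
                                   a :* p :+ a :* (z :* y) :+ a⁻ :* (y :+ z)) refl W (- W) π z y ⟩
      -- Trading `π` for `t⁺ + x` supplies the `x` needed to trade `x + z * y` for `t⁻ + (y + z)`;
      -- the linear terms then cancel.
      W * π + W * (z * y) + - W * (y + z)             ≈⟨ +-congʳ (+-congʳ (*-congˡ (T⁺-χ p))) ⟨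
      W * (t⁺ + x) + W * (z * y) + - W * (y + z)
        ≈⟨ solve 6 (λ a a⁻ t x r s → a :* (t :+ x) :+ a :* r :+ a⁻ :* s := a :* t :+ a :* (x :+ r) :+ a⁻ :* s)
             refl W (- W) t⁺ x (z * y) (y + z) ⟩
      W * t⁺ + W * (x + z * y) + - W * (y + z)        ≈⟨ +-congʳ (+-congˡ (*-congˡ (T⁻-χ p))) ⟨
      W * t⁺ + W * (t⁻ + (y + z)) + - W * (y + z)
        ≈⟨ solve 5 (λ a a⁻ t t′ s → a :* t :+ a :* (t′ :+ s) :+ a⁻ :* s := a :* (t :+ t′) :+ (a :+ a⁻) :* s)
             refl W (- W) t⁺ t⁻ (y + z) ⟩
      W * (t⁺ + t⁻) + (W + - W) * (y + z)             ≈⟨ +-congˡ (*-congʳ (-‿inverseʳ W)) ⟩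
      W * (t⁺ + t⁻) + 0# * (y + z)                    ≈⟨ +-congˡ (zeroˡ _) ⟩
      W * (t⁺ + t⁻) + 0#                              ≈⟨ +-identityʳ _ ⟩
      W * (t⁺ + t⁻)                                   ∎)
      where
      i  = toℕ (row p)
      j  = toℕ (col p)
      W  = w (suc i) (suc j)
      t⁺ = T⁺ p I
      t⁻ = T⁻ p I
      x  = χ (suc i) (suc j)
      y  = χ (suc (suc i)) (suc j)
      z  = χ (suc i) (suc (suc j))
      π  = χ i (suc j) * χ (suc i) j

    -- Both factors of the product are 1, and the weight absorbs the other indicators, so the four
    -- terms are `W`, `- W`, `- W`, `W`. Positions below `P n` thus add nothing, and a sum over
    -- `P n` may run over the whole grid.
    cell-below : ∀ i j → suc i ℕ.+ suc j ≤ n → 0# ≈ D i j + D′ (suc i) j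
    cell-below i j le = sym (begin
      D i j + D′ (suc i) j                            ≈⟨ D+D′ i j ⟩
      (W * (χ i (suc j) * χ (suc i) j) + - W * z) + (- W * y + W * (z * y))
        ≈⟨ +-cong (+-cong Wπ (trans (sym (-‿distribˡ-* W z)) (-‿cong Wz)))
                  (+-cong (trans (sym (-‿distribˡ-* W y)) (-‿cong Wy))
                          (trans (sym (*-assoc W z y)) (trans (*-congʳ Wz) Wy))) ⟩
      (W + - W) + (- W + W)                           ≈⟨ +-cong (-‿inverseʳ W) (-‿inverseˡ W) ⟩
      0# + 0#                                         ≈⟨ +-identityˡ 0# ⟩
      0#                                              ∎)
      where
      W  = w (suc i) (suc j)
      y  = χ (suc (suc i)) (suc j)
      z  = χ (suc i) (suc (suc j))
      Wy : W * y ≈ W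
      Wy = weight-absorb-row {suc i} {suc j} le
      Wz : W * z ≈ W
      Wz = weight-absorb-col {suc i} {suc j} le
      Wπ : W * (χ i (suc j) * χ (suc i) j) ≈ W
      Wπ = trans (*-congˡ (trans (*-cong
               (χ≈1 {i} {suc j} (ℕₚ.≤-trans (ℕₚ.n≤1+n _) le))
               (χ≈1 {suc i} {j} (ℕₚ.≤-trans (ℕₚ.+-monoʳ-≤ (suc i) (ℕₚ.n≤1+n j)) le)))
             (*-identityˡ 1#))) (*-identityʳ W)

    sum-row : ∀ i → ∑[ j < n ] D i (toℕ j) + ∑[ j < n ] D′ i (toℕ j) ≈ H i 0 + L i 0
    -- `D i j + D′ i j` amounts to `E j - E (suc j)`. Adding the shifted sum to both sides avoids
    -- the subtraction, and `E n` vanishes because column `n + 1` is outside.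
    sum-row i = +-cancelʳ (∑[ j < n ] E (suc (toℕ j))) _ _ (begin
      ∑[ j < n ] D i (toℕ j) + ∑[ j < n ] D′ i (toℕ j) + ∑[ j < n ] E (suc (toℕ j))
        ≈⟨ +-congʳ (∑-distrib-+ (D i ∘ toℕ {n}) (D′ i ∘ toℕ)) ⟨
      ∑[ j < n ] (D i (toℕ j) + D′ i (toℕ j)) + ∑[ j < n ] E (suc (toℕ j))
        ≈⟨ ∑-distrib-+ (λ j → D i (toℕ {n} j) + D′ i (toℕ j)) _ ⟨
      ∑[ j < n ] (D i (toℕ j) + D′ i (toℕ j) + E (suc (toℕ j)))  ≈⟨ sum-cong-≋ {n} (λ j → step (toℕ j)) ⟩
      ∑[ j < n ] E (toℕ j)                  ≈⟨ sum-shift n E En≈0 ⟨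
      ∑[ j < n ] E (suc (toℕ j)) + E 0      ≈⟨ +-comm _ _ ⟩
      E 0 + ∑[ j < n ] E (suc (toℕ j))      ∎)
      where
      E : ℕ → Carrier
      E j = H i j + L i j

      En≈0 : E n ≈ 0#
      En≈0 = trans (+-cong (trans (*-congˡ (trans (*-congʳ (χ-col≈0 i)) (zeroˡ _))) (zeroʳ _))
                           (trans (*-congˡ (χ-col≈0 (suc i))) (zeroʳ _)))
                   (+-identityˡ 0#)

      step : ∀ j → D i j + D′ i j + E (suc j) ≈ E j
      step j = begin
        (h - l⁺) + (l - h⁺) + (h⁺ + l⁺)
          ≈⟨ solve 6 (λ h l h⁺ l⁺ m⁺ k⁺ → (h :+ m⁺) :+ (l :+ k⁺) :+ (h⁺ :+ l⁺) :=
                                          (h :+ l) :+ ((h⁺ :+ k⁺) :+ (l⁺ :+ m⁺))) refl h l h⁺ l⁺ (- l⁺) (- h⁺) ⟩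
        (h + l) + ((h⁺ - h⁺) + (l⁺ - l⁺))  ≈⟨ +-congˡ (+-cong (-‿inverseʳ h⁺) (-‿inverseʳ l⁺)) ⟩
        (h + l) + (0# + 0#)                ≈⟨ +-congˡ (+-identityˡ 0#) ⟩
        (h + l) + 0#                       ≈⟨ +-identityʳ _ ⟩
        h + l                              ∎
        where
        h  = H i j
        l  = L i j
        h⁺ = H i (suc j)
        l⁺ = L i (suc j)

    -- Here the ideal drops out: the indicators at the start of a row are 1, except possibly `χ n 1`
    -- in the last row, where its weight is zero.
    row-start : ∀ i → suc i ≤ n → H i 0 + L i 0 ≈ ε i + ε i
    row-start i i<n = trans (+-cong
      (trans (*-congˡ (trans (*-cong (χ≈1 {i} {1} (≡.subst (_≤ n) (ℕₚ.+-comm 1 i) i<n)) (χ≈1 {suc i} {0} i+1+0≤n))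
                             (*-identityˡ 1#)))
             (*-identityʳ _))
      (weight-absorb-col {suc i} {0} i+1+0≤n))
      (weight-border n i)
      where
      i+1+0≤n : suc i ℕ.+ 0 ≤ n
      i+1+0≤n = ≡.subst (_≤ n) (≡.sym (ℕₚ.+-identityʳ (suc i))) i<n

    -- Both weights equal `- w 0 (suc j)`, which absorbs the extra factor `χ 0 (suc (suc j))` of the
    -- product.
    D′-first : ∀ j → suc j ≤ n → D′ 0 j ≈ 0#
    D′-first j j<n = x≈y⇒x∙y⁻¹≈ε (begin
      w 1 j * y                     ≈⟨ *-congʳ (weight-antidiagonal n 0 j) ⟩
      - W * y                       ≈⟨ *-congʳ (-‿cong (weight-absorb-col {0} {suc j} j<n)) ⟨
      - (W * z) * y                 ≈⟨ *-congʳ (-‿distribˡ-* W z) ⟩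
      - W * z * y                   ≈⟨ *-assoc _ _ _ ⟩
      - W * (z * y)                 ≈⟨ *-congʳ (weight-diagonal n 0 (suc j)) ⟨
      w 1 (suc (suc j)) * (z * y)   ∎)
      where
      W = w 0 (suc j)
      y = χ 1 (suc j)
      z = χ 0 (suc (suc j))

    D′-last : ∀ j → D′ n j ≈ 0#
    D′-last j = x≈y⇒x∙y⁻¹≈ε (trans
      (trans (*-congˡ (χ-row≈0 (suc j))) (zeroʳ _))
      (sym (trans (*-congˡ (trans (*-congˡ (χ-row≈0 (suc j))) (zeroʳ _))) (zeroʳ _))))

    sum-cells : ∑[ i < n ] ∑[ j < n ] (D (toℕ i) (toℕ j) + D′ (suc (toℕ i)) (toℕ j)) ≈ ∑[ i < n ] (ε (toℕ i) + ε (toℕ i))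
    sum-cells = begin
      ∑[ i < n ] ∑[ j < n ] (D (toℕ i) (toℕ j) + D′ (suc (toℕ i)) (toℕ j))
        ≈⟨ sum-cong-≋ {n} (λ i → ∑-distrib-+ (D (toℕ i) ∘ toℕ {n}) (D′ (suc (toℕ i)) ∘ toℕ)) ⟩
      ∑[ i < n ] (d (toℕ i) + d′ (suc (toℕ i)))           ≈⟨ ∑-distrib-+ (d ∘ toℕ {n}) _ ⟩
      ∑[ i < n ] d (toℕ i) + ∑[ i < n ] d′ (suc (toℕ i))
        -- `D′` is summed over rows 1 to n. Adding the zero row 0 and dropping the zero row `n`
        -- aligns it with `D`, so that each row telescopes.
        ≈⟨ +-congˡ (trans (sym (+-identityʳ _)) (+-congˡ (sym (sum-0 λ j → D′-first (toℕ j) (Finₚ.toℕ<n j))))) ⟩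
      ∑[ i < n ] d (toℕ i) + (∑[ i < n ] d′ (suc (toℕ i)) + d′ 0)
        ≈⟨ +-congˡ (sum-shift n d′ (sum-0 {n} λ j → D′-last (toℕ j))) ⟩
      ∑[ i < n ] d (toℕ i) + ∑[ i < n ] d′ (toℕ i)        ≈⟨ ∑-distrib-+ (d ∘ toℕ {n}) _ ⟨
      ∑[ i < n ] (d (toℕ i) + d′ (toℕ i))
        ≈⟨ sum-cong-≋ {n} (λ i → trans (sum-row (toℕ i)) (row-start (toℕ i) (Finₚ.toℕ<n i))) ⟩
      ∑[ i < n ] (ε (toℕ i) + ε (toℕ i))                  ∎
      where
      d d′ : ℕ → Carrier
      d  i = ∑[ j < n ] D  i (toℕ j)
      d′ i = ∑[ j < n ] D′ i (toℕ j)

    weighted-toggles : sumP (λ p → w ⟦ row p ⟧ ⟦ col p ⟧ * (T⁺ p I + T⁻ p I)) ≈ ∑[ i < n ] (ε (toℕ i) + ε (toℕ i))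
    weighted-toggles = trans (sum-cong-≋ {n} λ i → sum-cong-≋ {n} λ j → cell i j (InP? n i j)) sum-cells
      where
      cell : ∀ i j (m? : Dec (InP n i j)) → extendByZero (λ p → w ⟦ row p ⟧ ⟦ col p ⟧ * (T⁺ p I + T⁻ p I)) i j m? ≈
             D (toℕ i) (toℕ j) + D′ (suc (toℕ i)) (toℕ j)
      cell i j (yes m) = cell-P (pt i j m)
      cell i j (no ¬m) = cell-below (toℕ i) (toℕ j)
        (ℕ.s≤s⁻¹ (≡.subst (suc (⟦ i ⟧ ℕ.+ ⟦ j ⟧) ≤_) (ℕₚ.+-comm n 1) (ℕₚ.≰⇒> ¬m)))

  -- Linearity of sums over `P n`.

  module _ {n : ℕ} where

    sumP-cong : {f g : P n → Carrier} → (∀ p → f p ≈ g p) → sumP f ≈ sumP g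
    sumP-cong {f} {g} f≈g = sum-cong-≋ {n} λ i → sum-cong-≋ {n} λ j → cell i j (InP? n i j)
      where
      cell : ∀ i j m? → extendByZero f i j m? ≈ extendByZero g i j m?
      cell i j (yes m) = f≈g (pt i j m)
      cell i j (no _)  = refl

    sumP-+ : (f g : P n → Carrier) → sumP (λ p → f p + g p) ≈ sumP f + sumP g
    sumP-+ f g = begin
      sumP (λ p → f p + g p)  ≈⟨ sum-cong-≋ {n} (λ i → sum-cong-≋ {n} λ j → cell i j (InP? n i j)) ⟩
      ∑[ i < n ] ∑[ j < n ] (extendByZero f i j (InP? n i j) + extendByZero g i j (InP? n i j))
        ≈⟨ sum-cong-≋ {n} (λ i → ∑-distrib-+ {n} _ _) ⟩
      ∑[ i < n ] (∑[ j < n ] extendByZero f i j (InP? n i j) + ∑[ j < n ] extendByZero g i j (InP? n i j))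
        ≈⟨ ∑-distrib-+ {n} _ _ ⟩
      sumP f + sumP g         ∎
      where
      cell : ∀ i j m? → extendByZero (λ p → f p + g p) i j m? ≈ extendByZero f i j m? + extendByZero g i j m?
      cell i j (yes m) = refl
      cell i j (no _)  = sym (+-identityˡ 0#)

    *-distribˡ-sumP : ∀ x (f : P n → Carrier) → x * sumP f ≈ sumP (λ p → x * f p)
    *-distribˡ-sumP x f = begin
      x * sumP f  ≈⟨ *-distribˡ-sum {n} x _ ⟩
      ∑[ i < n ] (x * ∑[ j < n ] extendByZero f i j (InP? n i j))
        ≈⟨ sum-cong-≋ {n} (λ i → trans (*-distribˡ-sum {n} x _) (sum-cong-≋ {n} λ j → cell i j (InP? n i j))) ⟩
      sumP (λ p → x * f p)  ∎
      where
      cell : ∀ i j m? → x * extendByZero f i j m? ≈ extendByZero (λ p → x * f p) i j m?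
      cell i j (yes m) = refl
      cell i j (no _)  = zeroʳ x

    sum-sumP-comm : ∀ {m} (f : Fin m → P n → Carrier) →
      ∑[ k < m ] sumP (f k) ≈ sumP (λ p → ∑[ k < m ] f k p)
    sum-sumP-comm {m} f = begin
      ∑[ k < m ] sumP (f k)  ≈⟨ ∑-comm {m} {n} _ ⟩
      ∑[ i < n ] ∑[ k < m ] ∑[ j < n ] extendByZero (f k) i j (InP? n i j)
        ≈⟨ sum-cong-≋ {n} (λ i → trans (∑-comm {m} {n} _) (sum-cong-≋ {n} λ j → cell i j (InP? n i j))) ⟩
      sumP (λ p → ∑[ k < m ] f k p)  ∎
      where
      cell : ∀ i j m? → ∑[ k < m ] extendByZero (f k) i j m? ≈ extendByZero (λ p → ∑[ k < m ] f k p) i j m?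
      cell i j (yes _) = refl
      cell i j (no _)  = sum-0 {m} λ k → refl

  -- The alternating sum of rooks as a weighted sum of `T⁻`.

  -- `toℕ (opposite j)` is `n - ⟦ j ⟧`, which differs from `n + ⟦ j ⟧` by an even number.
  ε-opposite : ∀ {n} (j : Fin n) → ε (n ℕ.+ ⟦ j ⟧) ≈ ε (toℕ (opposite j))
  ε-opposite {n} j = trans (reflexive (≡.cong ε (≡.sym opp+2j))) (ε-+2* (toℕ (opposite j)) ⟦ j ⟧)
    where
    opp+2j : toℕ (opposite j) ℕ.+ (⟦ j ⟧ ℕ.+ ⟦ j ⟧) ≡ n ℕ.+ ⟦ j ⟧
    opp+2j = ≡.trans (≡.sym (ℕₚ.+-assoc (toℕ (opposite j)) ⟦ j ⟧ ⟦ j ⟧)) (≡.cong (ℕ._+ ⟦ j ⟧)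
      (≡.trans (≡.cong (ℕ._+ ⟦ j ⟧) (Finₚ.opposite-prop j)) (ℕₚ.m∸n+n≡m (Finₚ.toℕ<n j))))

  -- An element at `(a , b)` occurs in the row part of exactly one rook, `i = a`, and in the column
  -- part of exactly one, `i = n + 1 - b`. The accompanying inequalities follow from
  -- `a + b ≥ n + 1`. Since `Fin` counts from 0, the row sign is `ε (a - 1) = - ε a`.
  rook-weight : ∀ {n} (p : P n) x →
    ∑[ i < n ] (ε (toℕ i) *
      ((if does ((row p Finₚ.≟ i) ×-dec (n ℕ.+ 1 ℕ.∸ ⟦ i ⟧ ℕₚ.≤? ⟦ col p ⟧)) then x else 0#) +
       (if does ((⟦ i ⟧ ℕₚ.≤? ⟦ row p ⟧) ×-dec (⟦ col p ⟧ ℕₚ.≟ n ℕ.+ 1 ℕ.∸ ⟦ i ⟧)) then x else 0#)))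
    ≈ weight n ⟦ row p ⟧ ⟦ col p ⟧ * x
  rook-weight {n} p x = begin
    ∑[ i < n ] (ε (toℕ i) * ((if does (inRow? i) then x else 0#) + (if does (inCol? i) then x else 0#)))
      ≈⟨ trans (sum-cong-≋ {n} (λ i → distribˡ _ _ _)) (∑-distrib-+ {n} _ _) ⟩
    ∑[ i < n ] (ε (toℕ i) * (if does (inRow? i) then x else 0#)) +
    ∑[ i < n ] (ε (toℕ i) * (if does (inCol? i) then x else 0#))
      ≈⟨ +-cong
           (sum-select inRow? (row p) (≡.refl , ℕₚ.m≤n+o⇒m∸n≤o (n ℕ.+ 1) a n+1≤a+b) (λ i → ≡.sym ∘ proj₁) (ε ∘ toℕ) x)
           (sum-select inCol? (opposite (col p)) (opp≤a , b≡) (λ i → unique i ∘ proj₂) (ε ∘ toℕ) x) ⟩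
    ε (toℕ (row p)) * x + ε (toℕ (opposite (col p))) * x  ≈⟨ distribʳ _ _ _ ⟨
    (ε (toℕ (row p)) + ε (toℕ (opposite (col p)))) * x    ≈⟨ *-congʳ (+-comm _ _) ⟩
    (ε (toℕ (opposite (col p))) + ε (toℕ (row p))) * x
      ≈⟨ *-congʳ (+-cong (ε-opposite (col p)) (-ε-suc (toℕ (row p)))) ⟨
    weight n a b * x                                      ∎
    where
    a = ⟦ row p ⟧
    b = ⟦ col p ⟧

    inRow? : ∀ i → Dec (row p ≡ i × n ℕ.+ 1 ℕ.∸ ⟦ i ⟧ ≤ b)
    inRow? i = (row p Finₚ.≟ i) ×-dec (n ℕ.+ 1 ℕ.∸ ⟦ i ⟧ ℕₚ.≤? b)

    inCol? : ∀ i → Dec (⟦ i ⟧ ≤ a × b ≡ n ℕ.+ 1 ℕ.∸ ⟦ i ⟧)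
    inCol? i = (⟦ i ⟧ ℕₚ.≤? a) ×-dec (b ℕₚ.≟ n ℕ.+ 1 ℕ.∸ ⟦ i ⟧)

    n+1≤a+b : n ℕ.+ 1 ≤ a ℕ.+ b
    n+1≤a+b = ≡.subst (_≤ a ℕ.+ b) (ℕₚ.+-comm 1 n) (rank≥0 p)

    opp≤a : ⟦ opposite (col p) ⟧ ≤ a
    opp≤a = ≡.subst (λ k → suc k ≤ a) (≡.sym (Finₚ.opposite-prop (col p)))
      (s≤s (ℕₚ.m≤n+o⇒m∸n≤o n b (≡.subst (n ≤_) (ℕₚ.+-comm (toℕ (row p)) b) (ℕ.s≤s⁻¹ (rank≥0 p)))))

    n+1∸suc : ∀ k → n ℕ.+ 1 ℕ.∸ suc k ≡ n ℕ.∸ k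
    n+1∸suc k = ≡.cong (ℕ._∸ suc k) (ℕₚ.+-comm n 1)

    b≡ : b ≡ n ℕ.+ 1 ℕ.∸ ⟦ opposite (col p) ⟧
    b≡ = ≡.sym (≡.trans (n+1∸suc (toℕ (opposite (col p))))
      (≡.trans (≡.cong (n ℕ.∸_) (Finₚ.opposite-prop (col p))) (ℕₚ.m∸[m∸n]≡n (Finₚ.toℕ<n (col p)))))

    unique : ∀ i → b ≡ n ℕ.+ 1 ℕ.∸ ⟦ i ⟧ → i ≡ opposite (col p)
    -- Truncated subtraction from `n` is an involution on 0, ..., n, so `b` determines `i`.
    unique i eq = Finₚ.toℕ-injective (≡.sym (≡.trans (Finₚ.opposite-prop (col p))
      (≡.trans (≡.cong (n ℕ.∸_) (≡.trans eq (n+1∸suc (toℕ i)))) (ℕₚ.m∸[m∸n]≡n (ℕₚ.<⇒≤ (Finₚ.toℕ<n i))))))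

  alternating-R̄ : ∀ {n} (I : OrderIdeal n) →
    ∑[ i < n ] (ε (toℕ i) * R̄ i I) ≈ sumP (λ p → weight n ⟦ row p ⟧ ⟦ col p ⟧ * T⁻ p I)
  alternating-R̄ {n} I = trans
    (sum-cong-≋ {n} λ i → trans (*-congˡ (sym (sumP-+ {n} _ _))) (*-distribˡ-sumP {n} (ε (toℕ i)) _))
    (trans (sum-sumP-comm {n} {n} _) (sumP-cong λ p → rook-weight p (T⁻ p I)))

  -- The toggleability coefficients.

  module _ {½ r : Carrier} (½-reciprocal : Reciprocal-suc K 1# ½) (r-reciprocal : Reciprocal-suc K q r) where

    open Reciprocal-suc ½-reciprocal renaming (inverse to ½-inverse)
    open Reciprocal-suc r-reciprocal renaming (inverse to r-inverse)

    -- Since `c₀ (q + 1) = - ½`, the term `c₀ w T^q` splits into `½ w T⁻`, whose sum is the halved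
    -- rook sum, and `c₀ w (T⁺ + T⁻)`, whose sum is the constant `- g` for every ideal.
    alternating-R̄-≡^q : ∀ n g → g ≈ r * ∑[ i < n ] ε (toℕ i) →
      (λ (I : OrderIdeal n) → ½ * ∑[ i < n ] (ε (toℕ i) * R̄ i I)) ≡^q const g
    alternating-R̄-≡^q n g g≈ = (λ p → c₀ * wₚ p) , λ I → sym (begin
      sumP (λ p → c₀ * wₚ p * T^q p I)
        ≈⟨ sumP-cong (λ p → split (wₚ p) (T⁺ p I) (T⁻ p I)) ⟩
      sumP (λ p → ½ * (wₚ p * T⁻ p I) + c₀ * (wₚ p * (T⁺ p I + T⁻ p I)))
        ≈⟨ trans (sumP-+ {n} _ _) (sym (+-cong (*-distribˡ-sumP {n} ½ _) (*-distribˡ-sumP {n} c₀ _))) ⟩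
      ½ * sumP (λ p → wₚ p * T⁻ p I) + c₀ * sumP (λ p → wₚ p * (T⁺ p I + T⁻ p I))
        ≈⟨ +-cong (*-congˡ (sym (alternating-R̄ I))) (trans (*-congˡ (weighted-toggles I)) constant) ⟩
      ½ * ∑[ i < n ] (ε (toℕ i) * R̄ i I) - g  ∎)
      where
      c₀ : Carrier
      c₀ = - (½ * r)

      wₚ : P n → Carrier
      wₚ p = weight n ⟦ row p ⟧ ⟦ col p ⟧

      s : Carrier
      s = ∑[ i < n ] ε (toℕ i)

      constant : c₀ * ∑[ i < n ] (ε (toℕ i) + ε (toℕ i)) ≈ - g
      constant = begin
        c₀ * ∑[ i < n ] (ε (toℕ i) + ε (toℕ i))  ≈⟨ *-congˡ (∑-distrib-+ (ε ∘ toℕ {n}) _) ⟩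
        c₀ * (s + s)                     ≈⟨ -‿distribˡ-* _ _ ⟨
        - (½ * r * (s + s))
          ≈⟨ -‿cong (solve 3 (λ h r s → h :* r :* (s :+ s) := h :* (con 1 :+ con 1) :* (r :* s)) refl ½ r s) ⟩
        - (½ * (1# + 1#) * (r * s))      ≈⟨ -‿cong (trans (*-congʳ ½-inverse) (*-identityˡ _)) ⟩
        - (r * s)                        ≈⟨ -‿cong g≈ ⟨
        - g                              ∎

      ½+c₀[q+1]≈0 : ½ + c₀ * (q + 1#) ≈ 0#
      ½+c₀[q+1]≈0 = begin
        ½ + c₀ * (q + 1#)           ≈⟨ +-congˡ (-‿distribˡ-* _ _) ⟨
        ½ - ½ * r * (q + 1#)        ≈⟨ +-congˡ (-‿cong (trans (*-assoc _ _ _) (trans (*-congˡ r-inverse) (*-identityʳ ½)))) ⟩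
        ½ - ½                       ≈⟨ -‿inverseʳ ½ ⟩
        0#                          ∎

      split : ∀ w t⁺ t⁻ → c₀ * w * (t⁺ - q * t⁻) ≈ ½ * (w * t⁻) + c₀ * (w * (t⁺ + t⁻))
      split w t⁺ t⁻ = begin
        c₀ * w * (t⁺ - q * t⁻)                                 ≈⟨ +-identityˡ _ ⟨
        -- Zero is inserted as a multiple of `½ + c₀ (q + 1)`; after regrouping only
        -- `q * t⁻ - q * t⁻` has to cancel.
        0# + c₀ * w * (t⁺ - q * t⁻)                            ≈⟨ +-congʳ (trans (*-congʳ ½+c₀[q+1]≈0) (zeroˡ _)) ⟨
        (½ + c₀ * (q + 1#)) * (w * t⁻) + c₀ * w * (t⁺ - q * t⁻)
          ≈⟨ solve 7 (λ h c q w t t′ m → (h :+ c :* (q :+ con 1)) :* (w :* t′) :+ c :* w :* (t :+ m) :=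
                h :* (w :* t′) :+ c :* (w :* (t :+ t′)) :+ c :* w :* (q :* t′ :+ m))
               refl ½ c₀ q w t⁺ t⁻ (- (q * t⁻)) ⟩
        ½ * (w * t⁻) + c₀ * (w * (t⁺ + t⁻)) + c₀ * w * (q * t⁻ - q * t⁻)
          ≈⟨ +-congˡ (trans (*-congˡ (-‿inverseʳ _)) (zeroʳ _)) ⟩
        ½ * (w * t⁻) + c₀ * (w * (t⁺ + t⁻)) + 0#               ≈⟨ +-identityʳ _ ⟩
        ½ * (w * t⁻) + c₀ * (w * (t⁺ + t⁻))                    ∎

    alternating-R̄-parity : ∀ n → let f = λ (I : OrderIdeal n) → ½ * ∑[ i < n ] (ε (toℕ i) * R̄ i I) in
      (2 ∣ n → f ≡^q const 0#) × (2 ∤ n → f ≡^q const r)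
    alternating-R̄-parity n =
      (λ 2∣n → alternating-R̄-≡^q n 0# (sym (trans (*-congˡ (proj₁ (sum-ε n) 2∣n)) (zeroʳ r)))) ,
      (λ 2∤n → alternating-R̄-≡^q n r (sym (trans (*-congˡ (proj₂ (sum-ε n) 2∤n)) (*-identityʳ r))))

-- Reciprocals of fractions, and the passage to rational functions.

module _ {c ℓ} (D : IntegralDomain c ℓ) where
  open IntegralDomain D
  open Fractions D
  open Fraction
  open SetoidReasoning setoid
  open NatSolver commutativeSemiring using (solve; _:=_; _:+_; _:*_; con)

  -- Cross-multiplication. Stating the shapes of `a` and `x` as equations on numerators and
  -- denominators lets both applications discharge every hypothesis by reflexivity.
  reciprocal-suc : ∀ (a x : Fraction) →
    den a ≈ 1# → num x ≈ 1# → den x ≈ num a + 1# → Reciprocal-suc fractionRing a x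
  reciprocal-suc a x den-a≈ num-x≈ den-x≈ .Reciprocal-suc.inverse = mk≈ᶠ (begin
    num x * (num a * 1# + 1# * den a) * 1#   ≈⟨ *-congʳ (*-cong num-x≈ (+-congˡ (*-congˡ den-a≈))) ⟩
    1# * (num a * 1# + 1# * 1#) * 1#
      ≈⟨ solve 1 (λ a → con 1 :* (a :* con 1 :+ con 1 :* con 1) :* con 1 := con 1 :* ((a :+ con 1) :* (con 1 :* con 1))) refl (num a) ⟩
    1# * ((num a + 1#) * (1# * 1#))          ≈⟨ *-congˡ (*-cong den-x≈ (*-congʳ den-a≈)) ⟨
    1# * (den x * (den a * 1#))              ∎)

open import Defs

-- The domain ℝ[q] is written out at each use: behind a definition of its own it is no longer
-- syntactically the one inside ℝ⟨q⟩, and the type checker then compares the two by normalisation.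

private
  module ℝ[q] = IntegralDomain (Polynomials.polynomialDomain RationalFunctions.ℝ-domain)

½#-reciprocal : Reciprocal-suc ℝ⟨q⟩ 1# ½#
½#-reciprocal = reciprocal-suc (Polynomials.polynomialDomain RationalFunctions.ℝ-domain) 1# ½#
  (ℝ[q].refl {ℝ[q].1#}) (ℝ[q].refl {ℝ[q].1#}) (ℝ[q].refl {ℝ[q].1# ℝ[q].+ ℝ[q].1#})

1/[q+1]-reciprocal : Reciprocal-suc ℝ⟨q⟩ q 1/[q+1]
1/[q+1]-reciprocal = reciprocal-suc (Polynomials.polynomialDomain RationalFunctions.ℝ-domain) q 1/[q+1]
  (ℝ[q].refl {ℝ[q].1#}) (ℝ[q].refl {ℝ[q].1#}) (ℝ[q].refl {RationalFunctions.X ℝ[q].+ ℝ[q].1#})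

theorem5p17 : (n : ℕ) → 1 ≤ n →
    let f : OrderIdeal n → RationalFunction
        f I = ½# * (∑[ i < n ] ((- 1#) ^ toℕ i * R̄ i I))
    in (2 ∣ n → f ≡^q const 0#) × (2 ∤ n → f ≡^q const 1/[q+1])
theorem5p17 n _ =
  AlternatingRooks.alternating-R̄-parity ℝ⟨q⟩ q {½#} {1/[q+1]} ½#-reciprocal 1/[q+1]-reciprocal n
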